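{- There exist absolute constants $c>0$, $C>0$ and an absolute positive integer $N$ such that the following holds. Let $\mathbb{F}_q$ be a finite field, let $K\geqslant 1$, and let $A\subseteq T_2(\mathbb{F}_q)$ be a set such that $e\in A$ (where $e$ is the identity matrix), $A=A^{ -1}$, and $|A^3|\leqslant K|A|$. Then at least one of the following holds: 1. There is an $\mathbb{F}^*$-potent group $H$ such that $|A^2\cap H|\geqslant cK^{ -C}|A|$. 2. There is a subgroup $U\leqslant U_2(\mathbb{F}_q)$, normal in $\langle A\rangle$, such that $U\subseteq A^{N}$ and $\langle A\rangle/U$ is abelian.
   Context: $T_2(\mathbb{F}_q)$ denotes the group of invertible $2\times 2$ upper triangular matrices over the finite field $\mathbb{F}_q$ with $q$ elements ($q$ an arbitrary prime power). $U_2(\mathbb{F}_q)$ denotes its subgroup of unitriangular matrices (with $1$'s on the diagonal). For a subset $A$ of a group, $A^{ -1}=\{a^{ -1}: a\in A\}$, $A^n$ is the set of all $n$-fold products $a_1a_2\cdots a_n$ with $a_i\in A$, and $\langle A\rangle$ is the subgroup generated by $A$. A matrix in $T_2(\mathbb{F}_q)$ is called $\mathbb{F}^*$-potent if it has the form $\lambda u$ with $\lambda\in\mathbb{F}_q^*$ and $u\in U_2(\mathbb{F}_q)$; the $\mathbb{F}^*$-potent group is the abelian subgroup $$\left\{\begin{pmatrix} a & b\\ 0& a\end{pmatrix} : a\in\mathbb{F}_q^*,\ b\in\mathbb{F}_q\right\}$$ of $T_2(\mathbb{F}_q)$. -}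

module Defs where

open import Algebra.Apartness.Structures using (IsHeytingField)
open import Algebra.Bundles using (Group; CommutativeRing)
open import Algebra.Core using (Op₁; Op₂)
open import Algebra.Definitions using (Commutative)
import Algebra.Definitions.RawSemiring
open import Algebra.Structures using (IsGroup)
open import Data.Fin.Base using (Fin)
import Data.Fin.Properties as Fin
import Data.Integer.Base as ℤ
open import Data.List.Base using (List; []; _∷_; length; filter; map; allFin; cartesianProduct; cartesianProductWith)
open import Data.List.Membership.Propositional using (lose) renaming (_∈_ to _∈ˡ_)
open import Data.List.Membership.Propositional.Properties
  using (∈-map⁺; ∈-allFin; ∈-cartesianProduct⁺; ∈-cartesianProductWith⁺)
open import Data.List.Relation.Unary.All using (All; []; _∷_)
import Data.List.Relation.Unary.Any as Any
open import Data.List.Relation.Unary.Any using (here; there)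
open import Data.List.Relation.Unary.AllPairs using ([]; _∷_)
open import Data.List.Relation.Unary.Unique.Propositional using (Unique)
import Data.List.Relation.Unary.Unique.Propositional.Properties as Unique
open import Data.Nat.Base using (ℕ; zero; suc)
open import Data.Product.Base using (∃; ∃-syntax; _×_; _,_; proj₁; proj₂)
open import Data.Rational.Base using (ℚ; 1ℚ; 1/_; +-*-rawSemiring)
import Data.Rational.Base as ℚ
import Data.Rational.Properties as ℚ
open import Function.Bundles using (_↔_; module Inverse)
open import Function.Properties.Inverse using (↔⇒↣)
open import Level using (0ℓ)
open import Relation.Binary.Definitions using (DecidableEquality)
open import Relation.Binary.PropositionalEquality
open import Relation.Nullary using (Dec; yes; no; contradiction)
open import Relation.Nullary.Decidable using (map′; _×-dec_; via-injection)
open import Relation.Unary using (Pred; Decidable; _∈_; _⊆_; ｛_｝)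

open Algebra.Definitions.RawSemiring +-*-rawSemiring using (_^_)

fromℕ : ℕ → ℚ
fromℕ n = (ℤ.+ n) ℚ./ 1

-- Quantifying over rational K ≥ 1 and natural C loses no generality over
-- real ones: if |A³| ≤ K|A| for a real K, the same holds for the rational
-- number |A³|/|A|, which lies in [1, K], and c K⁻ᶜ is decreasing in K
-- and C.  The hypothesis 1 ≤ K is only used to know that K is invertible.
infixl 8 _^-_⟨_⟩

_^-_⟨_⟩ : (K : ℚ) (C : ℕ) → 1ℚ ℚ.≤ K → ℚ
K ^- C ⟨ 1≤K ⟩ = (1/ K) {{ℚ.>-nonZero (ℚ.<-≤-trans (ℚ.positive⁻¹ 1ℚ) 1≤K)}} ^ C

record Finite (X : Set) : Set where
  field
    elements : List X
    complete : ∀ x → x ∈ˡ elements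
    unique   : Unique elements

  ∣_∣ : {P : Pred X 0ℓ} → Decidable P → ℕ
  ∣ P? ∣ = length (filter P? elements)

  any? : {P : Pred X 0ℓ} → Decidable P → Dec (∃ P)
  any? P? = map′ Any.satisfied (λ (x , px) → lose (complete x) px) (Any.any? P? elements)

module Subsets {G : Set} {_∙_ : Op₂ G} {ε : G} {_⁻¹ : Op₁ G}
               (isGroup : IsGroup _≡_ _∙_ ε _⁻¹) where

  open IsGroup isGroup using (assoc; identityˡ; identityʳ; inverseˡ; inverseʳ)

  infixl 7 _·_
  infixl 8 _^ˢ_
  infix  9 _⁻¹ˢ

  _⁻¹ˢ : Pred G 0ℓ → Pred G 0ℓ
  (A ⁻¹ˢ) x = ∃[ a ] a ∈ A × x ≡ a ⁻¹

  _·_ : Pred G 0ℓ → Pred G 0ℓ → Pred G 0ℓ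
  (A · B) x = ∃[ a ] ∃[ b ] a ∈ A × b ∈ B × x ≡ a ∙ b

  _^ˢ_ : Pred G 0ℓ → ℕ → Pred G 0ℓ
  A ^ˢ zero  = ｛ ε ｝
  A ^ˢ suc n = A · (A ^ˢ n)

  -- Cardinalities are defined for decidable subsets; classically every
  -- subset of a finite group is one.
  module _ (_≟_ : DecidableEquality G) (finite : Finite G) where
    open Finite finite using (any?)

    ·-dec : ∀ {A B} → Decidable A → Decidable B → Decidable (A · B)
    ·-dec A? B? x = any? λ a → any? λ b → A? a ×-dec B? b ×-dec (x ≟ (a ∙ b))

    ^ˢ-dec : ∀ {A} → Decidable A → ∀ n → Decidable (A ^ˢ n)
    ^ˢ-dec A? zero    = ε ≟_
    ^ˢ-dec A? (suc n) = ·-dec A? (^ˢ-dec A? n)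

  record IsSubgroup (H : Pred G 0ℓ) : Set where
    field
      ε∈  : ε ∈ H
      ∙∈  : ∀ {x y} → x ∈ H → y ∈ H → (x ∙ y) ∈ H
      ⁻¹∈ : ∀ {x} → x ∈ H → (x ⁻¹) ∈ H

  data ⟨_⟩ (A : Pred G 0ℓ) : Pred G 0ℓ where
    gen : ∀ {x} → x ∈ A → ⟨ A ⟩ x
    one : ⟨ A ⟩ ε
    mul : ∀ {x y} → ⟨ A ⟩ x → ⟨ A ⟩ y → ⟨ A ⟩ (x ∙ y)
    inv : ∀ {x} → ⟨ A ⟩ x → ⟨ A ⟩ (x ⁻¹)

  ⟨⟩-isSubgroup : ∀ A → IsSubgroup ⟨ A ⟩
  ⟨⟩-isSubgroup A = record { ε∈ = one ; ∙∈ = mul ; ⁻¹∈ = inv }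

  infix 4 _⊴_

  record _⊴_ (U H : Pred G 0ℓ) : Set where
    field
      isSubgroupˡ : IsSubgroup U
      isSubgroupʳ : IsSubgroup H
      subset      : U ⊆ H
      conj        : ∀ {h u} → h ∈ H → u ∈ U → ((h ∙ u) ∙ (h ⁻¹)) ∈ U

  -- The quotient H/U: the elements of H, with x and y identified when
  -- x⁻¹y ∈ U, i.e. when xU = yU.
  quotient : ∀ {U H} → U ⊴ H → Group 0ℓ 0ℓ
  quotient {U} {H} U⊴H = record
    { Carrier = ∃ H
    ; _≈_ = λ (x , _) (y , _) → ((x ⁻¹) ∙ y) ∈ U
    ; _∙_ = λ (x , x∈) (y , y∈) → x ∙ y , H.∙∈ x∈ y∈
    ; ε = ε , H.ε∈
    ; _⁻¹ = λ (x , x∈) → x ⁻¹ , H.⁻¹∈ x∈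
    ; isGroup = record
      { isMonoid = record
        { isSemigroup = record
          { isMagma = record
            { isEquivalence = record
              { refl  = λ {x} → ≈-reflexive x x refl
              ; sym   = λ {x} {y} → ≈-sym x y
              ; trans = λ {x} {y} {z} p q → subst U (cancel (proj₁ x ⁻¹) (proj₁ y) (proj₁ z)) (U.∙∈ p q)
              }
            ; ∙-cong = λ {x} {y} {u} {v} → ≈-cong x y u v
            }
          ; assoc = λ { (x , x∈) (y , y∈) (z , z∈) →
            ≈-reflexive (_ , H.∙∈ (H.∙∈ x∈ y∈) z∈) (_ , H.∙∈ x∈ (H.∙∈ y∈ z∈)) (assoc x y z) }
          }
        ; identity = (λ (x , x∈) → ≈-reflexive (_ , H.∙∈ H.ε∈ x∈) (x , x∈) (identityˡ x))
                     , (λ (x , x∈) → ≈-reflexive (_ , H.∙∈ x∈ H.ε∈) (x , x∈) (identityʳ x))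
        }
      ; inverse = (λ (x , x∈) → ≈-reflexive (_ , H.∙∈ (H.⁻¹∈ x∈) x∈) (ε , H.ε∈) (inverseˡ x))
                     , (λ (x , x∈) → ≈-reflexive (_ , H.∙∈ x∈ (H.⁻¹∈ x∈)) (ε , H.ε∈) (inverseʳ x))
      ; ⁻¹-cong = λ {x} {y} → ≈-inv x y
      }
    }
    where
    module U = IsSubgroup (_⊴_.isSubgroupˡ U⊴H)
    module H = IsSubgroup (_⊴_.isSubgroupʳ U⊴H)
    open ≡-Reasoning

    Gr : Group 0ℓ 0ℓ
    Gr = record { isGroup = isGroup }
    open import Algebra.Properties.Group Gr using (⁻¹-anti-homo-∙; ⁻¹-involutive)

    anti-homo : ∀ x y → (x ∙ y) ⁻¹ ≡ (y ⁻¹) ∙ (x ⁻¹)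
    anti-homo = ⁻¹-anti-homo-∙

    invol : ∀ x → (x ⁻¹) ⁻¹ ≡ x
    invol = ⁻¹-involutive

    ≈-reflexive : (x y : ∃ H) → proj₁ x ≡ proj₁ y → ((proj₁ x ⁻¹) ∙ proj₁ y) ∈ U
    ≈-reflexive (x , _) _ refl = subst U (sym (inverseˡ x)) U.ε∈

    ≈-sym : (x y : ∃ H) → ((proj₁ x ⁻¹) ∙ proj₁ y) ∈ U → ((proj₁ y ⁻¹) ∙ proj₁ x) ∈ U
    ≈-sym (x , _) (y , _) p =
      subst U (trans (anti-homo (x ⁻¹) y) (cong ((y ⁻¹) ∙_) (invol x))) (U.⁻¹∈ p)

    cancel : ∀ x y z → (x ∙ y) ∙ ((y ⁻¹) ∙ z) ≡ x ∙ z
    cancel x y z = begin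
      (x ∙ y) ∙ ((y ⁻¹) ∙ z)  ≡⟨ assoc x y _ ⟩
      x ∙ (y ∙ ((y ⁻¹) ∙ z))  ≡⟨ cong (x ∙_) (sym (assoc y _ z)) ⟩
      x ∙ ((y ∙ (y ⁻¹)) ∙ z)  ≡⟨ cong (λ t → x ∙ (t ∙ z)) (inverseʳ y) ⟩
      x ∙ (ε ∙ z)             ≡⟨ cong (x ∙_) (identityˡ z) ⟩
      x ∙ z                   ∎

    conj′ : ∀ {h u} → h ∈ H → u ∈ U → (((h ⁻¹) ∙ u) ∙ h) ∈ U
    conj′ {h} {u} h∈ u∈ =
      subst (λ t → (((h ⁻¹) ∙ u) ∙ t) ∈ U) (invol h) (_⊴_.conj U⊴H (H.⁻¹∈ h∈) u∈)

    ≈-cong : (x y u v : ∃ H) →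
             ((proj₁ x ⁻¹) ∙ proj₁ y) ∈ U → ((proj₁ u ⁻¹) ∙ proj₁ v) ∈ U →
             (((proj₁ x ∙ proj₁ u) ⁻¹) ∙ (proj₁ y ∙ proj₁ v)) ∈ U
    ≈-cong (x , _) (y , _) (u , u∈) (v , _) p q = subst U eq (U.∙∈ (conj′ u∈ p) q)
      where
      eq : (((u ⁻¹) ∙ ((x ⁻¹) ∙ y)) ∙ u) ∙ ((u ⁻¹) ∙ v) ≡ ((x ∙ u) ⁻¹) ∙ (y ∙ v)
      eq = begin
        (((u ⁻¹) ∙ ((x ⁻¹) ∙ y)) ∙ u) ∙ ((u ⁻¹) ∙ v)  ≡⟨ cancel _ u v ⟩
        ((u ⁻¹) ∙ ((x ⁻¹) ∙ y)) ∙ v                    ≡⟨ cong (_∙ v) (sym (assoc _ _ y)) ⟩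
        (((u ⁻¹) ∙ (x ⁻¹)) ∙ y) ∙ v                    ≡⟨ cong (λ t → (t ∙ y) ∙ v) (sym (anti-homo x u)) ⟩
        (((x ∙ u) ⁻¹) ∙ y) ∙ v                          ≡⟨ assoc _ y v ⟩
        ((x ∙ u) ⁻¹) ∙ (y ∙ v)                          ∎

    ≈-inv : (x y : ∃ H) → ((proj₁ x ⁻¹) ∙ proj₁ y) ∈ U →
            (((proj₁ x ⁻¹) ⁻¹) ∙ (proj₁ y ⁻¹)) ∈ U
    ≈-inv (x , x∈) (y , _) p = subst U eq (_⊴_.conj U⊴H x∈ (U.⁻¹∈ p))
      where
      eq : (x ∙ (((x ⁻¹) ∙ y) ⁻¹)) ∙ (x ⁻¹) ≡ ((x ⁻¹) ⁻¹) ∙ (y ⁻¹)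
      eq = begin
        (x ∙ (((x ⁻¹) ∙ y) ⁻¹)) ∙ (x ⁻¹)          ≡⟨ cong (λ t → (x ∙ t) ∙ (x ⁻¹)) (anti-homo _ y) ⟩
        (x ∙ ((y ⁻¹) ∙ ((x ⁻¹) ⁻¹))) ∙ (x ⁻¹)     ≡⟨ cong (λ t → (x ∙ ((y ⁻¹) ∙ t)) ∙ (x ⁻¹)) (invol x) ⟩
        (x ∙ ((y ⁻¹) ∙ x)) ∙ (x ⁻¹)               ≡⟨ cong (_∙ (x ⁻¹)) (sym (assoc x _ x)) ⟩
        ((x ∙ (y ⁻¹)) ∙ x) ∙ (x ⁻¹)               ≡⟨ assoc _ x _ ⟩
        (x ∙ (y ⁻¹)) ∙ (x ∙ (x ⁻¹))               ≡⟨ cong ((x ∙ (y ⁻¹)) ∙_) (inverseʳ x) ⟩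
        (x ∙ (y ⁻¹)) ∙ ε                           ≡⟨ identityʳ _ ⟩
        x ∙ (y ⁻¹)                                 ≡⟨ cong (_∙ (y ⁻¹)) (sym (invol x)) ⟩
        ((x ⁻¹) ⁻¹) ∙ (y ⁻¹)                       ∎

IsAbelian : Group 0ℓ 0ℓ → Set
IsAbelian G = Commutative _≈_ _∙_ where open Group G

-- A Heyting field whose apartness relation is _≢_ is a field in the
-- usual sense: every x ≢ 0# is invertible, and 0# is not.
record FiniteField : Set₁ where
  infixl 7 _*_
  infixl 6 _+_
  infix  8 -_
  field
    Carrier : Set
    _+_ _*_ : Op₂ Carrier
    -_      : Op₁ Carrier
    0# 1#   : Carrier
    isHeytingField : IsHeytingField _≡_ _≢_ _+_ _*_ -_ 0# 1#
    q           : ℕ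
    enumeration : Carrier ↔ Fin q

  open IsHeytingField isHeytingField public
    using ( isCommutativeRing; #⇒invertible; invertible⇒#
          ; +-assoc; +-comm; +-identityˡ; +-identityʳ; -‿inverseˡ; -‿inverseʳ
          ; *-assoc; *-comm; *-identityˡ; *-identityʳ; distribˡ; distribʳ; zeroˡ; zeroʳ)

  commutativeRing : CommutativeRing 0ℓ 0ℓ
  commutativeRing = record { isCommutativeRing = isCommutativeRing }

  open import Algebra.Properties.Ring (CommutativeRing.ring commutativeRing) public
    using (-0#≈0#; -‿distribˡ-*; -‿distribʳ-*)

  infix 4 _≟_

  _≟_ : DecidableEquality Carrier
  _≟_ = via-injection (↔⇒↣ enumeration) Fin._≟_

  finite : Finite Carrier
  finite = record
    { elements = map from (allFin q)
    ; complete = λ x → subst (_∈ˡ map from (allFin q)) (strictlyInverseʳ x) (∈-map⁺ from (∈-allFin (to x)))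
    ; unique   = Unique.map⁺ from-injective (Unique.allFin⁺ q)
    }
    where
    open Inverse enumeration
    from-injective : ∀ {i j} → from i ≡ from j → i ≡ j
    from-injective {i} {j} eq =
      trans (sym (strictlyInverseˡ i)) (trans (cong to eq) (strictlyInverseˡ j))

  x-0≡x : ∀ x → x + - 0# ≡ x
  x-0≡x x = trans (cong (x +_) -0#≈0#) (+-identityʳ x)

  inv : ∀ {x} → x ≢ 0# → Carrier
  inv x≢0 = proj₁ (#⇒invertible x≢0)

  inv-inverseˡ : ∀ {x} (x≢0 : x ≢ 0#) → inv x≢0 * x ≡ 1#
  inv-inverseˡ {x} x≢0 =
    trans (cong (inv x≢0 *_) (sym (x-0≡x x))) (proj₁ (proj₂ (#⇒invertible x≢0)))

  1≢0 : 1# ≢ 0#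
  1≢0 = invertible⇒# (1# , trans (*-identityˡ _) (x-0≡x 1#) , trans (*-identityʳ _) (x-0≡x 1#))

  *-≢0 : ∀ {x y} → x ≢ 0# → y ≢ 0# → x * y ≢ 0#
  *-≢0 {x} {y} x≢0 y≢0 xy≡0 = y≢0 (begin
    y                  ≡⟨ sym (*-identityˡ y) ⟩
    1# * y             ≡⟨ cong (_* y) (sym (inv-inverseˡ x≢0)) ⟩
    (inv x≢0 * x) * y  ≡⟨ *-assoc _ _ _ ⟩
    inv x≢0 * (x * y)  ≡⟨ cong (inv x≢0 *_) xy≡0 ⟩
    inv x≢0 * 0#       ≡⟨ zeroʳ _ ⟩
    0#                 ∎)
    where open ≡-Reasoning

  inv-≢0 : ∀ {x} (x≢0 : x ≢ 0#) → inv x≢0 ≢ 0#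
  inv-≢0 {x} x≢0 eq =
    1≢0 (trans (sym (inv-inverseˡ x≢0)) (trans (cong (_* x) eq) (zeroˡ x)))

module Triangular (F : FiniteField) where
  open FiniteField F renaming (Carrier to 𝔽; finite to 𝔽-finite)

  -- The matrix ( a b ; 0 d ); it is invertible iff a and d are nonzero.
  -- Proofs of _≢_ are definitionally equal, so _≡_ on T₂ is equality of
  -- matrices.
  record T₂ : Set where
    constructor mk
    field
      a b d : 𝔽
      a≢0   : a ≢ 0#
      d≢0   : d ≢ 0#

  open T₂

  T₂-≡ : ∀ {x y} → a x ≡ a y → b x ≡ b y → d x ≡ d y → x ≡ y
  T₂-≡ {mk _ _ _ _ _} {mk _ _ _ _ _} refl refl refl = refl

  T₂-≟ : DecidableEquality T₂
  T₂-≟ x y = map′ (λ (p , q , r) → T₂-≡ p q r) (λ { refl → refl , refl , refl })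
                  ((a x ≟ a y) ×-dec (b x ≟ b y) ×-dec (d x ≟ d y))

  infixl 7 _∙_
  infix  8 _⁻¹
  infixr 7 _•_

  _∙_ : Op₂ T₂
  x ∙ y = mk (a x * a y) (a x * b y + b x * d y) (d x * d y)
             (*-≢0 (a≢0 x) (a≢0 y)) (*-≢0 (d≢0 x) (d≢0 y))

  ε : T₂
  ε = mk 1# 0# 1# 1≢0 1≢0

  _⁻¹ : Op₁ T₂
  x ⁻¹ = mk (inv (a≢0 x)) (- (inv (a≢0 x) * b x * inv (d≢0 x))) (inv (d≢0 x))
            (inv-≢0 (a≢0 x)) (inv-≢0 (d≢0 x))

  _•_ : ∃ (_≢ 0#) → T₂ → T₂
  (c , c≢0) • x = mk (c * a x) (c * b x) (c * d x) (*-≢0 c≢0 (a≢0 x)) (*-≢0 c≢0 (d≢0 x))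

  isGroup : IsGroup _≡_ _∙_ ε _⁻¹
  isGroup = record
    { isMonoid = record
      { isSemigroup = record
        { isMagma = record { isEquivalence = isEquivalence ; ∙-cong = cong₂ _∙_ }
        ; assoc = λ x y z → T₂-≡ (*-assoc _ _ _) (assoc-b x y z) (*-assoc _ _ _)
        }
      ; identity =
          (λ x → T₂-≡ (*-identityˡ _)
                      (trans (cong₂ _+_ (*-identityˡ _) (zeroˡ _)) (+-identityʳ _))
                      (*-identityˡ _))
        , (λ x → T₂-≡ (*-identityʳ _)
                      (trans (cong₂ _+_ (zeroʳ _) (*-identityʳ _)) (+-identityˡ _))
                      (*-identityʳ _))
      }
    ; inverse = inverseˡ , inverseʳ
    ; ⁻¹-cong = cong _⁻¹
    }
    where
    open ≡-Reasoning

    assoc-b : ∀ x y z → b ((x ∙ y) ∙ z) ≡ b (x ∙ (y ∙ z))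
    assoc-b x y z = begin
      (a x * a y) * b z + (a x * b y + b x * d y) * d z
        ≡⟨ cong₂ _+_ (*-assoc _ _ _) (distribʳ _ _ _) ⟩
      a x * (a y * b z) + ((a x * b y) * d z + (b x * d y) * d z)
        ≡⟨ cong (_ +_) (cong₂ _+_ (*-assoc _ _ _) (*-assoc _ _ _)) ⟩
      a x * (a y * b z) + (a x * (b y * d z) + b x * (d y * d z))
        ≡⟨ sym (+-assoc _ _ _) ⟩
      (a x * (a y * b z) + a x * (b y * d z)) + b x * (d y * d z)
        ≡⟨ cong (_+ _) (sym (distribˡ _ _ _)) ⟩
      a x * (a y * b z + b y * d z) + b x * (d y * d z) ∎

    inverseˡ : ∀ x → x ⁻¹ ∙ x ≡ ε
    inverseˡ x = T₂-≡ (inv-inverseˡ (a≢0 x)) eq (inv-inverseˡ (d≢0 x))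
      where
      a′ = inv (a≢0 x)
      d′ = inv (d≢0 x)

      eq : a′ * b x + - (a′ * b x * d′) * d x ≡ 0#
      eq = begin
        a′ * b x + - (a′ * b x * d′) * d x    ≡⟨ cong (a′ * b x +_) (sym (-‿distribˡ-* _ _)) ⟩
        a′ * b x + - (a′ * b x * d′ * d x)    ≡⟨ cong (λ t → a′ * b x + - t) (*-assoc _ _ _) ⟩
        a′ * b x + - (a′ * b x * (d′ * d x))  ≡⟨ cong (λ t → a′ * b x + - (a′ * b x * t)) (inv-inverseˡ (d≢0 x)) ⟩
        a′ * b x + - (a′ * b x * 1#)          ≡⟨ cong (λ t → a′ * b x + - t) (*-identityʳ _) ⟩
        a′ * b x + - (a′ * b x)               ≡⟨ -‿inverseʳ _ ⟩
        0#                                    ∎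

    inverseʳ : ∀ x → x ∙ x ⁻¹ ≡ ε
    inverseʳ x = T₂-≡ aa′≡1 eq (trans (*-comm _ _) (inv-inverseˡ (d≢0 x)))
      where
      a′ = inv (a≢0 x)
      d′ = inv (d≢0 x)

      aa′≡1 : a x * a′ ≡ 1#
      aa′≡1 = trans (*-comm _ _) (inv-inverseˡ (a≢0 x))

      eq : a x * - (a′ * b x * d′) + b x * d′ ≡ 0#
      eq = begin
        a x * - (a′ * b x * d′) + b x * d′      ≡⟨ cong (_+ b x * d′) (sym (-‿distribʳ-* _ _)) ⟩
        - (a x * (a′ * b x * d′)) + b x * d′    ≡⟨ cong (λ t → - (a x * t) + b x * d′) (*-assoc _ _ _) ⟩
        - (a x * (a′ * (b x * d′))) + b x * d′  ≡⟨ cong (λ t → - t + b x * d′) (sym (*-assoc _ _ _)) ⟩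
        - (a x * a′ * (b x * d′)) + b x * d′    ≡⟨ cong (λ t → - (t * (b x * d′)) + b x * d′) aa′≡1 ⟩
        - (1# * (b x * d′)) + b x * d′          ≡⟨ cong (λ t → - t + b x * d′) (*-identityˡ _) ⟩
        - (b x * d′) + b x * d′                 ≡⟨ -‿inverseˡ _ ⟩
        0#                                      ∎

  private
    units : List 𝔽 → List (∃ (_≢ 0#))
    units [] = []
    units (x ∷ xs) with x ≟ 0#
    ... | yes _   = units xs
    ... | no  x≢0 = (x , x≢0) ∷ units xs

    units-complete : ∀ {xs x} (x≢0 : x ≢ 0#) → x ∈ˡ xs → (x , x≢0) ∈ˡ units xs
    units-complete {y ∷ xs} x≢0 x∈ with y ≟ 0# | x∈
    ... | yes y≡0 | here refl = contradiction y≡0 x≢0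
    ... | yes _   | there x∈′ = units-complete x≢0 x∈′
    ... | no  _   | here refl = here refl
    ... | no  _   | there x∈′ = there (units-complete x≢0 x∈′)

    units-≢ : ∀ {y} (y≢0 : y ≢ 0#) {xs} → All (y ≢_) xs → All ((y , y≢0) ≢_) (units xs)
    units-≢ y≢0 [] = []
    units-≢ y≢0 (_∷_ {x} y≢x ps) with x ≟ 0#
    ... | yes _ = units-≢ y≢0 ps
    ... | no  _ = (λ eq → y≢x (cong proj₁ eq)) ∷ units-≢ y≢0 ps

    units-unique : ∀ {xs} → Unique xs → Unique (units xs)
    units-unique [] = []
    units-unique (_∷_ {x} p ps) with x ≟ 0#
    ... | yes _   = units-unique ps
    ... | no  x≢0 = units-≢ x≢0 p ∷ units-unique ps

    assemble : ∃ (_≢ 0#) × ∃ (_≢ 0#) → 𝔽 → T₂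
    assemble ((a , a≢0) , (d , d≢0)) b = mk a b d a≢0 d≢0

  finite : Finite T₂
  finite = record
    { elements = cartesianProductWith assemble (cartesianProduct 𝔽* 𝔽*) 𝔽.elements
    ; complete = λ x → ∈-cartesianProductWith⁺ assemble
        (∈-cartesianProduct⁺ (units-complete (a≢0 x) (𝔽.complete (a x)))
                             (units-complete (d≢0 x) (𝔽.complete (d x))))
        (𝔽.complete (b x))
    ; unique = Unique.cartesianProductWith⁺ assemble (λ { refl → refl , refl })
        (Unique.cartesianProduct⁺ 𝔽*-unique 𝔽*-unique) 𝔽.unique
    }
    where
    module 𝔽 = Finite 𝔽-finite

    𝔽* : List (∃ (_≢ 0#))
    𝔽* = units 𝔽.elements

    𝔽*-unique : Unique 𝔽*
    𝔽*-unique = units-unique 𝔽.unique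

  open Finite finite public using (∣_∣)
  open Subsets isGroup public

  infixl 8 _^?_

  _^?_ : ∀ {A} → Decidable A → ∀ n → Decidable (A ^ˢ n)
  _^?_ = ^ˢ-dec T₂-≟ finite

  U₂ : Pred T₂ 0ℓ
  U₂ x = a x ≡ 1# × d x ≡ 1#

  IsF*Potent : Pred T₂ 0ℓ
  IsF*Potent x = ∃[ c ] ∃[ u ] u ∈ U₂ × x ≡ c • u

  -- Equivalently, H is a subgroup of the group of all matrices with equal
  -- diagonal entries.
  record IsF*PotentGroup (H : Pred T₂ 0ℓ) : Set where
    field
      isSubgroup : IsSubgroup H
      potent     : H ⊆ IsF*Potent

{-# OPTIONS --safe #-}
module Submission where

-- For β in the field let u β = (1 β; 0 1), let V n be the set of β with u β ∈ Aⁿ,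
-- let χ g = a/d for g = (a b; 0 d), and let Υ = χ(A).  Since the kernel of χ is the
-- F*-potent group, conclusion 1 holds unless Υ is large, and Ruzsa's triangle inequality
-- then shows 2 |V n| ≤ |V 2| |Υ| for n = 28.  In that case (x , y) ↦ δ (x + y w) cannot be
-- injective on V 2 × Υ if its values lie in V n, and a collision gives a nonzero
-- difference y − z of elements of Υ with (y − z) w ∈ V 4: w is not a pivot.
--
-- Pivots are excluded by induction on m.  If s = χ g₀ ≠ 1 with g₀ ∈ A, the elements δ with
-- g g₀ = u δ g₀ g for some g ∈ Aᵐ are not pivots, hence neither is any β ∈ V m, because
-- g = u β has δ = (1 − s) β.  So for every w ∈ V m a nonzero multiple of the image of
-- (x , y) ↦ x + y w lies in V n.  Two distinct points of V 2 × Υ collide for at most one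
-- w, and therefore |V m| < 2 |V n| for all m, which forces V m ⊆ V n + V n ⊆ V (2n).
-- Thus U = ⟨A⟩ ∩ U₂ is contained in A²ⁿ.

open import Defs
open import Algebra.Bundles using (CommutativeRing; Group)
open import Algebra.Core using (Op₁; Op₂)
import Algebra.Definitions.RawSemiring
import Algebra.Properties.Group
import Algebra.Properties.Ring
open import Algebra.Structures using (IsGroup)
import Data.Integer.Base as ℤ
import Data.Integer.Properties as ℤ
open import Data.List.Base using (List; []; _∷_; _++_; length; filter; map; take; cartesianProduct)
open import Data.List.Membership.Propositional using (find; lose) renaming (_∈_ to _∈ˡ_)
open import Data.List.Membership.Propositional.Properties
  using ( ∈-∃++; ∈-++⁺ˡ; ∈-++⁺ʳ; ∈-++⁻; ∈-map⁻; ∈-filter⁺; ∈-filter⁻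
        ; ∈-cartesianProduct⁺; ∈-cartesianProduct⁻)
open import Data.List.Properties using (length-++; length-map; length-take; length-++-sucʳ)
import Data.List.Relation.Unary.All as All
open import Data.List.Relation.Unary.All using (All; []; _∷_)
open import Data.List.Relation.Unary.AllPairs using ([]; _∷_)
import Data.List.Relation.Unary.Any as Any
open import Data.List.Relation.Unary.Any using (here; there)
open import Data.List.Relation.Unary.Unique.Propositional using (Unique)
import Data.List.Relation.Unary.Unique.Propositional.Properties as Unique
open import Data.Nat using (ℕ)
open import Data.Nat.Base as ℕ using (zero; suc; z≤n; s≤s)
open import Data.Nat.Base using () renaming (_<_ to _<ℕ_)
open import Data.Nat.ListAction using (sum)
import Data.Nat.Properties as ℕ
open import Data.Nat.Tactic.RingSolver using (solve-∀)
open import Data.Product using (∃-syntax; Σ-syntax; _×_; _,_; proj₁; proj₂)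
open import Data.Rational using (ℚ; 0ℚ; 1ℚ; ½; _<_; _≤_)
import Data.Rational.Base as ℚ
import Data.Rational.Properties as ℚ
import Data.Rational.Unnormalised.Base as ℚᵘ
import Data.Rational.Unnormalised.Properties as ℚᵘ
open import Data.Sum as Sum using (_⊎_; inj₁; inj₂)
open import Level using (0ℓ)
open import Relation.Binary.Definitions using (DecidableEquality)
open import Relation.Binary.PropositionalEquality
open import Relation.Nullary using (¬_; yes; no; contradiction)
open import Relation.Nullary.Decidable using (_×-dec_; ¬?)
open import Relation.Unary using (Pred; Decidable; _∈_; _⊆_; _≐_; _∩_)
open import Relation.Unary.Properties using (_∩?_)


-- Counting by injective relations.

-- A relation rather than a function, so that a partner may be an arbitrary witness. The induction
-- deletes the partner of `x` from `ys`; by injectivity no later element needs it.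
length-injection : {X Y : Set} (R : X → Y → Set) {xs : List X} {ys : List Y} → Unique xs →
  (∀ {x} → x ∈ˡ xs → ∃[ y ] y ∈ˡ ys × R x y) →
  (∀ {x x′ y} → x ∈ˡ xs → x′ ∈ˡ xs → R x y → R x′ y → x ≡ x′) →
  length xs ℕ.≤ length ys
length-injection R [] total injective = z≤n
length-injection R {x ∷ xs} (x∉xs ∷ unique) total injective with total (here refl)
... | y , y∈ys , Rxy with ∈-∃++ y∈ys
... | us , vs , refl rewrite length-++-sucʳ us y vs =
  s≤s (length-injection R unique total′ (λ p q → injective (there p) (there q)))
  where
  total′ : ∀ {z} → z ∈ˡ xs → ∃[ t ] t ∈ˡ us ++ vs × R z t
  total′ z∈xs with total (there z∈xs)
  ... | t , t∈ , Rzt with ∈-++⁻ us t∈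
  ... | inj₁ t∈us         = t , ∈-++⁺ˡ t∈us , Rzt
  ... | inj₂ (there t∈vs) = t , ∈-++⁺ʳ us t∈vs , Rzt
  ... | inj₂ (here refl)  =
    contradiction (injective (here refl) (there z∈xs) Rxy Rzt) (All.lookup x∉xs z∈xs)

length-cartesianProduct : {X Y : Set} (xs : List X) (ys : List Y) →
  length (cartesianProduct xs ys) ≡ length xs ℕ.* length ys
length-cartesianProduct []       ys = refl
length-cartesianProduct (x ∷ xs) ys = trans (length-++ (map (x ,_) ys))
  (cong₂ ℕ._+_ (length-map (x ,_) ys) (length-cartesianProduct xs ys))

module FiniteSubsets {X : Set} (finite : Finite X) where
  open Finite finite public using (∣_∣; any?)
  open Finite finite using (elements; complete; unique)

  list : {P : Pred X 0ℓ} → Decidable P → List X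
  list P? = filter P? elements

  module _ {P : Pred X 0ℓ} (P? : Decidable P) where
    ∈-list⁺ : ∀ {x} → P x → x ∈ˡ list P?
    ∈-list⁺ = ∈-filter⁺ P? (complete _)

    ∈-list⁻ : ∀ {x} → x ∈ˡ list P? → P x
    ∈-list⁻ x∈ = proj₂ (∈-filter⁻ P? {xs = elements} x∈)

    list-unique : Unique (list P?)
    list-unique = Unique.filter⁺ P? unique

    nonempty : ∀ {x} → P x → 0 ℕ.< ∣ P? ∣
    nonempty px with list P? | ∈-list⁺ px
    ... | _ ∷ _ | _ = s≤s z≤n

  ∣∣-mono : {P Q : Pred X 0ℓ} (P? : Decidable P) (Q? : Decidable Q) → P ⊆ Q → ∣ P? ∣ ℕ.≤ ∣ Q? ∣
  ∣∣-mono P? Q? P⊆Q = length-injection _≡_ (list-unique P?)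
    (λ x∈ → _ , ∈-list⁺ Q? (P⊆Q (∈-list⁻ P? x∈)) , refl) (λ _ _ p q → trans p (sym q))

  -- The selected point depends on `i` alone, so a counting map built from it can be inverted by
  -- recovering `i` first. `x₀` is the default where `P i` is empty.
  selector : {I : Set} {P : I → Pred X 0ℓ} → (∀ i → Decidable (P i)) → X →
             Σ[ f ∈ (I → X) ] ∀ {i x} → P i x → P i (f i)
  selector {I} {P} P? x₀ = f , λ {i} → f-∈ i
    where
    f : I → X
    f i with any? (P? i)
    ... | yes (x , _) = x
    ... | no  _       = x₀

    f-∈ : ∀ i {x} → P i x → P i (f i)
    f-∈ i {x} px with any? (P? i)
    ... | yes (_ , p) = p
    ... | no  ¬∃      = contradiction (x , px) ¬∃

module _ {X Y : Set} (fX : Finite X) (fY : Finite Y) {P : Pred X 0ℓ} {Q : Pred Y 0ℓ}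
         (P? : Decidable P) (Q? : Decidable Q) where
  private
    module X = FiniteSubsets fX
    module Y = FiniteSubsets fY

  pairs : List (X × Y)
  pairs = cartesianProduct (X.list P?) (Y.list Q?)

  ∈-pairs⁺ : ∀ {x y} → P x → Q y → (x , y) ∈ˡ pairs
  ∈-pairs⁺ px qy = ∈-cartesianProduct⁺ (X.∈-list⁺ P? px) (Y.∈-list⁺ Q? qy)

  ∈-pairs⁻ : ∀ {x y} → (x , y) ∈ˡ pairs → P x × Q y
  ∈-pairs⁻ xy∈ with ∈-cartesianProduct⁻ (X.list P?) (Y.list Q?) xy∈
  ... | x∈ , y∈ = X.∈-list⁻ P? x∈ , Y.∈-list⁻ Q? y∈

  pairs-unique : Unique pairs
  pairs-unique = Unique.cartesianProduct⁺ (X.list-unique P?) (Y.list-unique Q?)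

  length-pairs : length pairs ≡ X.∣ P? ∣ ℕ.* Y.∣ Q? ∣
  length-pairs = length-cartesianProduct (X.list P?) (Y.list Q?)

-- Counting collisions in a family of maps `f w`.

-- The binomial coefficient n(n - 1)/2, which counts pairs of distinct points.
triangle : ℕ → ℕ
triangle zero    = 0
triangle (suc n) = n ℕ.+ triangle n

triangle-double : ∀ n → triangle n ℕ.+ triangle n ℕ.+ n ≡ n ℕ.* n
triangle-double zero    = refl
triangle-double (suc n) = trans (rearrange n (triangle n))
  (trans (cong (λ t → t ℕ.+ n ℕ.+ suc n) (triangle-double n)) (square n))
  where
  rearrange : ∀ n t → n ℕ.+ t ℕ.+ (n ℕ.+ t) ℕ.+ suc n ≡ t ℕ.+ t ℕ.+ n ℕ.+ n ℕ.+ suc n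
  rearrange = solve-∀

  square : ∀ n → n ℕ.* n ℕ.+ n ℕ.+ suc n ≡ suc n ℕ.* suc n
  square = solve-∀

module Collisions {W S Y : Set} (_≟_ : DecidableEquality Y) (f : W → S → Y) where

  collides? : ∀ p ps → Decidable (λ w → Any.Any (λ p′ → f w p ≡ f w p′) ps)
  collides? p ps w = Any.any? (λ p′ → f w p ≟ f w p′) ps

  -- One point from each fibre of `f w` on the list, namely the last one; the length is therefore
  -- the size of the image.
  representatives : W → List S → List S
  representatives w []       = []
  representatives w (p ∷ ps) with collides? p ps w
  ... | yes _ = representatives w ps
  ... | no  _ = p ∷ representatives w ps

  representatives-⊆ : ∀ w ps {p} → p ∈ˡ representatives w ps → p ∈ˡ ps
  representatives-⊆ w (p ∷ ps) p∈ with collides? p ps w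
  ... | yes _ = there (representatives-⊆ w ps p∈)
  representatives-⊆ w (p ∷ ps) (here refl) | no _ = here refl
  representatives-⊆ w (p ∷ ps) (there p∈)  | no _ = there (representatives-⊆ w ps p∈)

  representatives-injective : ∀ w ps {p p′} →
    p ∈ˡ representatives w ps → p′ ∈ˡ representatives w ps → f w p ≡ f w p′ → p ≡ p′
  representatives-injective w (p ∷ ps) p∈ p′∈ eq with collides? p ps w
  ... | yes _ = representatives-injective w ps p∈ p′∈ eq
  representatives-injective w (p ∷ ps) (here refl) (here refl) eq | no _ = refl
  representatives-injective w (p ∷ ps) (here refl) (there p′∈) eq | no ¬c =
    contradiction (lose (representatives-⊆ w ps p′∈) eq) ¬c
  representatives-injective w (p ∷ ps) (there p∈) (here refl) eq | no ¬c =
    contradiction (lose (representatives-⊆ w ps p∈) (sym eq)) ¬c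
  representatives-injective w (p ∷ ps) (there p∈) (there p′∈) eq | no _ =
    representatives-injective w ps p∈ p′∈ eq

  representatives-unique : ∀ w {ps} → Unique ps → Unique (representatives w ps)
  representatives-unique w [] = []
  representatives-unique w {p ∷ ps} (p∉ps ∷ unique) with collides? p ps w
  ... | yes _ = representatives-unique w unique
  ... | no  _ = All.tabulate (λ q∈ → All.lookup p∉ps (representatives-⊆ w ps q∈))
                ∷ representatives-unique w unique

  total : List W → List S → ℕ
  total ws ps = sum (map (λ w → length (representatives w ps)) ws)

  private
    move : ∀ l a t → suc l ℕ.+ (a ℕ.+ t) ≡ suc (a ℕ.+ (l ℕ.+ t))
    move = solve-∀

  -- For each `w`, the new point `p` either enlarges the image by one or is a collision.
  total-∷ : ∀ ws p ps →
    length ws ℕ.+ total ws ps ≡ total ws (p ∷ ps) ℕ.+ length (filter (collides? p ps) ws)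
  total-∷ []       p ps = refl
  total-∷ (w ∷ ws) p ps with collides? p ps w
  ... | yes _ = trans (move (length ws) (length (representatives w ps)) (total ws ps)) (trans
                  (cong (λ t → suc (length (representatives w ps) ℕ.+ t)) (total-∷ ws p ps))
                  (move′ (length (representatives w ps)) (total ws (p ∷ ps)) _))
    where
    move′ : ∀ a t c → suc (a ℕ.+ (t ℕ.+ c)) ≡ a ℕ.+ t ℕ.+ suc c
    move′ = solve-∀
  ... | no  _ = trans (move (length ws) (length (representatives w ps)) (total ws ps)) (trans
                  (cong (λ t → suc (length (representatives w ps) ℕ.+ t)) (total-∷ ws p ps))
                  (cong suc (sym (ℕ.+-assoc (length (representatives w ps)) (total ws (p ∷ ps)) _))))

  module _ (separated : ∀ {p p′ w w′} → p ≢ p′ → f w p ≡ f w p′ → f w′ p ≡ f w′ p′ → w ≡ w′)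
           {ws : List W} (ws-unique : Unique ws) where

    collisions-≤ : ∀ p ps → All (p ≢_) ps → length (filter (collides? p ps) ws) ℕ.≤ length ps
    collisions-≤ p ps p∉ps = length-injection (λ w p′ → p ≢ p′ × f w p ≡ f w p′)
      (Unique.filter⁺ (collides? p ps) ws-unique)
      (λ w∈ → let p′ , p′∈ , eq = find (proj₂ (∈-filter⁻ (collides? p ps) {xs = ws} w∈))
              in p′ , p′∈ , All.lookup p∉ps p′∈ , eq)
      (λ _ _ (p≢p′ , eq) (_ , eq′) → separated p≢p′ eq eq′)

    -- A point p collides with an earlier one for at most one w per earlier point.
    total-≥ : ∀ {ps} → Unique ps →
      length ws ℕ.* length ps ℕ.≤ total ws ps ℕ.+ triangle (length ps)
    total-≥ {[]} [] = ℕ.≤-trans (ℕ.≤-reflexive (ℕ.*-zeroʳ (length ws))) z≤n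
    total-≥ {p ∷ ps} (p∉ps ∷ unique) = begin
      length ws ℕ.* suc (length ps)
        ≡⟨ ℕ.*-suc (length ws) (length ps) ⟩
      length ws ℕ.+ length ws ℕ.* length ps
        ≤⟨ ℕ.+-monoʳ-≤ (length ws) (total-≥ unique) ⟩
      length ws ℕ.+ (total ws ps ℕ.+ triangle (length ps))
        ≡⟨ ℕ.+-assoc (length ws) (total ws ps) _ ⟨
      length ws ℕ.+ total ws ps ℕ.+ triangle (length ps)
        ≡⟨ cong (ℕ._+ triangle (length ps)) (total-∷ ws p ps) ⟩
      total ws (p ∷ ps) ℕ.+ length (filter (collides? p ps) ws) ℕ.+ triangle (length ps)
        ≤⟨ ℕ.+-monoˡ-≤ _ (ℕ.+-monoʳ-≤ (total ws (p ∷ ps)) (collisions-≤ p ps p∉ps)) ⟩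
      total ws (p ∷ ps) ℕ.+ length ps ℕ.+ triangle (length ps)
        ≡⟨ ℕ.+-assoc (total ws (p ∷ ps)) (length ps) _ ⟩
      total ws (p ∷ ps) ℕ.+ triangle (length (p ∷ ps)) ∎
      where open ℕ.≤-Reasoning

  total-≤ : ∀ {v} ws ps → (∀ {w} → w ∈ˡ ws → length (representatives w ps) ℕ.≤ v) →
            total ws ps ℕ.≤ length ws ℕ.* v
  total-≤ []       ps bound = z≤n
  total-≤ (w ∷ ws) ps bound = ℕ.+-mono-≤ (bound (here refl)) (total-≤ ws ps (λ w∈ → bound (there w∈)))

  -- With m parameters and exactly 2v points, `total-≥` and `total-≤` give 2vm ≤ mv + v(2v - 1),
  -- hence m ≤ 2v - 1.
  few-parameters : (∀ {p p′ w w′} → p ≢ p′ → f w p ≡ f w p′ → f w′ p ≡ f w′ p′ → w ≡ w′) →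
    ∀ {ws ps v} → Unique ws → Unique ps → 0 ℕ.< v → length ps ≡ v ℕ.+ v →
    (∀ {w} → w ∈ˡ ws → length (representatives w ps) ℕ.≤ v) → length ws ℕ.< v ℕ.+ v
  few-parameters separated {ws} {ps} {v} ws-unique ps-unique 0<v ps≡2v bound =
    ℕ.*-cancelʳ-≤ (suc m) (v ℕ.+ v) v {{ℕ.>-nonZero 0<v}} (begin
      v ℕ.+ m ℕ.* v    ≤⟨ ℕ.+-monoʳ-≤ v mv≤t ⟩
      v ℕ.+ t          ≡⟨ half ⟩
      (v ℕ.+ v) ℕ.* v  ∎)
    where
    open ℕ.≤-Reasoning
    m = length ws
    t = triangle (v ℕ.+ v)

    mv≤t : m ℕ.* v ℕ.≤ t
    mv≤t = ℕ.+-cancelˡ-≤ (m ℕ.* v) _ _ (subst (ℕ._≤ m ℕ.* v ℕ.+ t) (ℕ.*-distribˡ-+ m v v)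
      (subst (λ n → m ℕ.* n ℕ.≤ m ℕ.* v ℕ.+ triangle n) ps≡2v
        (ℕ.≤-trans (total-≥ separated ws-unique ps-unique) (ℕ.+-monoˡ-≤ _ (total-≤ ws ps bound)))))

    half : v ℕ.+ t ≡ (v ℕ.+ v) ℕ.* v
    half = ℕ.*-cancelʳ-≡ _ _ 2 (trans (rearrange v t) (trans (triangle-double (v ℕ.+ v)) (square v)))
      where
      rearrange : ∀ v t → (v ℕ.+ t) ℕ.* 2 ≡ t ℕ.+ t ℕ.+ (v ℕ.+ v)
      rearrange = solve-∀

      square : ∀ v → (v ℕ.+ v) ℕ.* (v ℕ.+ v) ≡ (v ℕ.+ v) ℕ.* v ℕ.* 2
      square = solve-∀

-- Field arithmetic.

module FieldLemmas (F : FiniteField) where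
  open FiniteField F public renaming (Carrier to 𝔽; finite to 𝔽-finite)
  open CommutativeRing commutativeRing public using (_-_)
  open Algebra.Properties.Ring (CommutativeRing.ring commutativeRing) public
    using ( [y-z]x≈yx-zx; -‿involutive; +-cancelˡ; +-cancelʳ
          ; x∙y⁻¹≈ε⇒x≈y; //-rightDividesʳ; //-rightDividesˡ)

  open ≡-Reasoning

  *-cancelˡ-≢0 : ∀ {x y z} → x ≢ 0# → x * y ≡ x * z → y ≡ z
  *-cancelˡ-≢0 {x} {y} {z} x≢0 eq = begin
    y                  ≡⟨ undo y ⟩
    inv x≢0 * (x * y)  ≡⟨ cong (inv x≢0 *_) eq ⟩
    inv x≢0 * (x * z)  ≡⟨ undo z ⟨
    z                  ∎
    where
    undo : ∀ t → t ≡ inv x≢0 * (x * t)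
    undo t = trans (sym (*-identityˡ t))
      (trans (cong (_* t) (sym (inv-inverseˡ x≢0))) (*-assoc _ _ _))

  x-y≢0 : ∀ {x y} → x ≢ y → x - y ≢ 0#
  x-y≢0 x≢y eq = x≢y (x∙y⁻¹≈ε⇒x≈y _ _ eq)

  x*[y*z]≡y*[x*z] : ∀ x y z → x * (y * z) ≡ y * (x * z)
  x*[y*z]≡y*[x*z] x y z = trans (sym (*-assoc x y z)) (trans (cong (_* z) (*-comm x y)) (*-assoc y x z))

  +-swap-difference : ∀ {x y z w} → x + y ≡ z + w → y - w ≡ z - x
  +-swap-difference {x} {y} {z} {w} eq = +-cancelˡ x _ _ (begin
    x + (y - w)  ≡⟨ +-assoc x y (- w) ⟨
    x + y - w    ≡⟨ cong (_- w) eq ⟩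
    z + w - w    ≡⟨ //-rightDividesʳ w z ⟩
    z            ≡⟨ //-rightDividesˡ x z ⟨
    z - x + x    ≡⟨ +-comm _ x ⟩
    x + (z - x)  ∎)

-- Pivots and the uniform bound on `V m`.

module _ (F : FiniteField) where
  open FieldLemmas F

  -- The argument is additive and uses only these closure rules: sums add the indices of `V`, and
  -- multiplication by an element of `Υ` costs 2.
  module Pivots
    (Υ : Pred 𝔽 0ℓ) (Υ? : Decidable Υ)
    (V : ℕ → Pred 𝔽 0ℓ) (V? : ∀ n → Decidable (V n))
    (V-0 : ∀ n → V n 0#)
    (V-+ : ∀ {m n x y} → V m x → V n y → V (m ℕ.+ n) (x + y))
    (V-neg : ∀ {n x} → V n x → V n (- x))
    (V-mono : ∀ {m n} → m ℕ.≤ n → V m ⊆ V n)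
    (Υ-V : ∀ {n x y} → Υ y → V n x → V (2 ℕ.+ n) (y * x))
    -- 28 = 8 + 20 is what nonPivot-step needs.
    (n : ℕ) (28≤n : 28 ℕ.≤ n)
    where

    open FiniteSubsets 𝔽-finite

    V-- : ∀ {m n x y} → V m x → V n y → V (m ℕ.+ n) (x - y)
    V-- Vx Vy = V-+ Vx (V-neg Vy)

    Υ-Υ-V : ∀ {m x y z} → Υ y → Υ z → V m x → V ((2 ℕ.+ m) ℕ.+ (2 ℕ.+ m)) ((y - z) * x)
    Υ-Υ-V {m} {x} {y} {z} Υy Υz Vx =
      subst (V _) (sym ([y-z]x≈yx-zx x y z)) (V-- (Υ-V Υy Vx) (Υ-V Υz Vx))

    -- For all other w the map (x , y) ↦ x + y * w is injective on V 2 × Υ.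
    NonPivot : Pred 𝔽 0ℓ
    NonPivot w = ∃[ y ] ∃[ z ] Υ y × Υ z × y ≢ z × V 4 ((y - z) * w)

    nonPivot? : Decidable NonPivot
    nonPivot? w = any? λ y → any? λ z → Υ? y ×-dec Υ? z ×-dec ¬? (y ≟ z) ×-dec V? 4 ((y - z) * w)

    -- An equality with y ≠ y′ gives (y - y′) w = x′ - x, a difference of two elements of `V 2`;
    -- this is the source of the 4 in `NonPivot`.
    collision : ∀ {x x′ y y′ w} → V 2 x → V 2 x′ → Υ y → Υ y′ →
                x + y * w ≡ x′ + y′ * w → NonPivot w ⊎ (x , y) ≡ (x′ , y′)
    collision {x} {x′} {y} {y′} {w} Vx Vx′ Υy Υy′ eq with y ≟ y′
    ... | yes refl = inj₂ (cong (_, y) (+-cancelʳ (y * w) x x′ eq))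
    ... | no y≢y′  = inj₁ (y , y′ , Υy , Υy′ , y≢y′ ,
      subst (V 4) (trans (sym (+-swap-difference eq)) (sym ([y-z]x≈yx-zx w y y′))) (V-- Vx′ Vx))

    points : List (𝔽 × 𝔽)
    points = pairs 𝔽-finite 𝔽-finite (V? 2) Υ?

    ∈-points⁻ : ∀ {x y} → (x , y) ∈ˡ points → V 2 x × Υ y
    ∈-points⁻ = ∈-pairs⁻ 𝔽-finite 𝔽-finite (V? 2) Υ?

    points-unique : Unique points
    points-unique = pairs-unique 𝔽-finite 𝔽-finite (V? 2) Υ?

    module _ (many : ∣ V? n ∣ ℕ.+ ∣ V? n ∣ ℕ.≤ ∣ V? 2 ∣ ℕ.* ∣ Υ? ∣) where

      many-points : ∣ V? n ∣ ℕ.+ ∣ V? n ∣ ℕ.≤ length points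
      many-points = ℕ.≤-trans many (ℕ.≤-reflexive (sym (length-pairs 𝔽-finite 𝔽-finite (V? 2) Υ?)))

      0<v : 0 ℕ.< ∣ V? n ∣
      0<v = nonempty (V? n) (V-0 n)

      δx+y*w : ∀ δ x y w → δ * (x + y * w) ≡ δ * x + y * (δ * w)
      δx+y*w δ x y w = trans (distribˡ δ x (y * w)) (cong (δ * x +_) (x*[y*z]≡y*[x*z] δ y w))

      -- For a pivot `w` the map (x , y) ↦ δ (x + y w) would embed `V 2` × `Υ` in `V n`, against
      -- `many`. The factor δ allows a `w` that is itself in no known `V m`, as long as δ w is.
      nonPivot : ∀ {δ w i j} → δ ≢ 0# → i ℕ.+ j ℕ.≤ 28 →
                 (∀ {x} → V 2 x → V i (δ * x)) → (∀ {y} → Υ y → V j (y * (δ * w))) → NonPivot w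
      nonPivot {δ} {w} {i} {j} δ≢0 i+j≤ V-δ Υ-δw with nonPivot? w
      ... | yes q = q
      ... | no ¬q = contradiction
        (ℕ.<-≤-trans (ℕ.m<m+n ∣ V? n ∣ 0<v) (ℕ.≤-trans many-points injection))
        (ℕ.<-irrefl refl)
        where
        injection : length points ℕ.≤ ∣ V? n ∣
        injection = length-injection (λ (x , y) z → z ≡ δ * (x + y * w))
          points-unique
          (λ {(x , y)} p∈ → let Vx , Υy = ∈-points⁻ p∈ in
            _ , ∈-list⁺ (V? n) (subst (V n) (sym (δx+y*w δ x y w))
              (V-mono (ℕ.≤-trans i+j≤ 28≤n) (V-+ (V-δ Vx) (Υ-δw Υy)))) , refl)
          (λ p∈ p′∈ e e′ → let Vx , Υy = ∈-points⁻ p∈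
                               Vx′ , Υy′ = ∈-points⁻ p′∈ in
            Sum.fromInj₂ (λ q → contradiction q ¬q) (collision Vx Vx′ Υy Υy′ (*-cancelˡ-≢0 δ≢0 (trans (sym e) e′))))

      nonPivot-0 : ∀ {y z} → Υ y → Υ z → y ≢ z → NonPivot 0#
      nonPivot-0 Υy Υz y≢z = _ , _ , Υy , Υz , y≢z , subst (V 4) (sym (zeroʳ _)) (V-0 4)

      -- Take δ = y - z from the witness for `w`. Then δ x ∈ `V 12` and s (δ w) ∈ `V 6`, so δ (x + s
      -- w) ∈ `V 18`; a factor from `Υ` makes this 20, and δ maps `V 2` into `V 8`.
      nonPivot-step : ∀ {x s w} → V 4 x → Υ s → NonPivot w → NonPivot (x + s * w)
      nonPivot-step {x} {s} {w} Vx Υs (y , z , Υy , Υz , y≢z , Vdw) =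
        nonPivot {i = 8} {j = 20} (x-y≢0 y≢z) ℕ.≤-refl (Υ-Υ-V Υy Υz) (λ Υt → Υ-V Υt Vd[x+sw])
        where
        Vd[x+sw] : V 18 ((y - z) * (x + s * w))
        Vd[x+sw] = subst (V 18) (sym (δx+y*w (y - z) x s w)) (V-+ (Υ-Υ-V Υy Υz Vx) (Υ-V Υs Vdw))

      -- Here δ = (y - z)(1 - s), so that δ w ∈ `V 4` is the hypothesis. For x ∈ `V 2`, x - s x lies
      -- in `V 6`, and multiplication by y - z brings it to `V 16`.
      nonPivot-[1-s]* : ∀ {s w} → Υ s → s ≢ 1# → NonPivot (w - s * w) → NonPivot w
      nonPivot-[1-s]* {s} {w} Υs s≢1 (y , z , Υy , Υz , y≢z , Vd) =
        nonPivot {i = 16} {j = 6} (*-≢0 (x-y≢0 y≢z) (x-y≢0 (λ e → s≢1 (sym e)))) (ℕ.m≤m+n 22 6)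
          (λ {x} Vx → subst (V 16) (factor x) (Υ-Υ-V Υy Υz (V-+ Vx (V-neg (Υ-V Υs Vx)))))
          (λ Υt → Υ-V Υt (subst (V 4) (factor w) Vd))
        where
        factor : ∀ x → (y - z) * (x - s * x) ≡ (y - z) * (1# - s) * x
        factor x = trans (cong ((y - z) *_) (trans (cong (_- s * x) (sym (*-identityˡ x)))
          (sym ([y-z]x≈yx-zx x 1# s)))) (sym (*-assoc _ _ x))

      module _ {m : ℕ} (nonPivots : ∀ {w} → V m w → NonPivot w) where

        affine : 𝔽 → 𝔽 × 𝔽 → 𝔽
        affine w (x , y) = x + y * w

        open Collisions _≟_ affine

        -- A point (x , y) is the line w ↦ x + y w, and two distinct lines agree for at most one
        -- `w`.
        separated : ∀ {p p′ w w′} → p ≢ p′ →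
                    affine w p ≡ affine w p′ → affine w′ p ≡ affine w′ p′ → w ≡ w′
        separated {x , y} {x′ , y′} {w} {w′} p≢p′ eq eq′ with y ≟ y′
        ... | yes refl = contradiction (cong (_, y) (+-cancelʳ (y * w) x x′ eq)) p≢p′
        ... | no y≢y′  = *-cancelˡ-≢0 (x-y≢0 y≢y′) (begin
          (y - y′) * w      ≡⟨ [y-z]x≈yx-zx w y y′ ⟩
          y * w - y′ * w    ≡⟨ +-swap-difference eq ⟩
          x′ - x            ≡⟨ +-swap-difference eq′ ⟨
          y * w′ - y′ * w′  ≡⟨ [y-z]x≈yx-zx w′ y y′ ⟨
          (y - y′) * w′     ∎)
          where open ≡-Reasoning

        -- Cut down to exactly 2 |V n| points, the number that `few-parameters` asks for.
        selection : List (𝔽 × 𝔽)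
        selection = take (∣ V? n ∣ ℕ.+ ∣ V? n ∣) points

        selection-unique : Unique selection
        selection-unique = Unique.take⁺ (∣ V? n ∣ ℕ.+ ∣ V? n ∣) points-unique

        V-few : ∣ V? m ∣ ℕ.< ∣ V? n ∣ ℕ.+ ∣ V? n ∣
        V-few = few-parameters separated (list-unique (V? m))
          selection-unique 0<v
          (trans (length-take _ points) (ℕ.m≤n⇒m⊓n≡m many-points))
          image-≤
          where
          -- Multiplication by the nonzero y - z carries the image into `V 14`: 8 for the term from
          -- `V 2`, and 6 for `Υ` times (y - z) w ∈ `V 4`.
          image-≤ : ∀ {w} → w ∈ˡ list (V? m) → length (representatives w selection) ℕ.≤ ∣ V? n ∣
          image-≤ {w} w∈ with nonPivots (∈-list⁻ (V? m) w∈)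
          ... | y , z , Υy , Υz , y≢z , Vdw =
            length-injection (λ p t → t ≡ (y - z) * affine w p)
              (representatives-unique w selection-unique)
              (λ {(x , s)} p∈ → let Vx , Υs = ∈-points⁻ (take-⊆ _ (representatives-⊆ w selection p∈)) in
                _ , ∈-list⁺ (V? n) (V-mono (ℕ.≤-trans (ℕ.m≤m+n 14 14) 28≤n)
                  (subst (V 14) (sym (δx+y*w (y - z) x s w)) (V-+ (Υ-Υ-V Υy Υz Vx) (Υ-V Υs Vdw)))) , refl)
              (λ p∈ p′∈ e e′ → representatives-injective w selection p∈ p′∈
                (*-cancelˡ-≢0 (x-y≢0 y≢z) (trans (sym e) e′)))
            where
            take-⊆ : ∀ {X : Set} k {xs : List X} {x} → x ∈ˡ take k xs → x ∈ˡ xs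
            take-⊆ (suc k) {_ ∷ _} (here refl) = here refl
            take-⊆ (suc k) {_ ∷ _} (there x∈)  = there (take-⊆ k x∈)

      -- V n and its reflection about β/2 lie in V (n + m) and are too large to be disjoint.
      V⊆V+V : (∀ {m w} → V m w → NonPivot w) → ∀ {m β} → V m β → V (n ℕ.+ n) β
      V⊆V+V nonPivots {m} {β} Vβ with any? (λ x → V? n x ×-dec V? n (β - x))
      ... | yes (x , Vx , Vβ-x) = subst (V (n ℕ.+ n))
        (trans (+-comm x _) (//-rightDividesˡ x β)) (V-+ Vx Vβ-x)
      ... | no ¬meet = contradiction (V-few {m ℕ.+ n} nonPivots) (ℕ.≤⇒≯ two-copies)
        where
        reflected : List 𝔽
        reflected = map (λ x → β - x) (list (V? n))

        reflect-injective : ∀ {x y} → β - x ≡ β - y → x ≡ y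
        reflect-injective {x} {y} eq = trans (sym (-‿involutive x))
          (trans (cong -_ (+-cancelˡ β _ _ eq)) (-‿involutive y))

        two-copies : ∣ V? n ∣ ℕ.+ ∣ V? n ∣ ℕ.≤ ∣ V? (m ℕ.+ n) ∣
        two-copies = ℕ.≤-trans (ℕ.≤-reflexive (sym (trans (length-++ (list (V? n)))
            (cong (∣ V? n ∣ ℕ.+_) (length-map _ (list (V? n)))))))
          (length-injection _≡_
            (Unique.++⁺ (list-unique (V? n)) (Unique.map⁺ reflect-injective (list-unique (V? n))) disjoint)
            (λ x∈ → _ , ∈-list⁺ (V? (m ℕ.+ n)) (both x∈) , refl)
            (λ _ _ p q → trans p (sym q)))
          where
          disjoint : ∀ {x} → ¬ (x ∈ˡ list (V? n) × x ∈ˡ reflected)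
          disjoint (x∈ , x∈′) with ∈-map⁻ (λ x → β - x) x∈′
          ... | y , y∈ , refl = ¬meet (y , ∈-list⁻ (V? n) y∈ , ∈-list⁻ (V? n) x∈)

          both : ∀ {x} → x ∈ˡ list (V? n) ++ reflected → V (m ℕ.+ n) x
          both x∈ with ∈-++⁻ (list (V? n)) x∈
          ... | inj₁ x∈ˡ = V-mono (ℕ.m≤n+m n m) (∈-list⁻ (V? n) x∈ˡ)
          ... | inj₂ x∈ʳ with ∈-map⁻ (λ x → β - x) x∈ʳ
          ... | y , y∈ , refl = V-- Vβ (∈-list⁻ (V? n) y∈)

-- Groups with a unipotent part, and the counting inequalities in them.

-- A group with a character χ : G → 𝔽* and a copy u of (𝔽 , +) that contains all
-- commutators and on which g acts by conjugation as multiplication by χ g.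
record UnipotentExtension (F : FiniteField) : Set₁ where
  open FieldLemmas F
  infixl 7 _∙_
  infix  8 _⁻¹
  field
    G          : Set
    _∙_        : Op₂ G
    ε          : G
    _⁻¹        : Op₁ G
    isGroup    : IsGroup _≡_ _∙_ ε _⁻¹
    _≟ᴳ_       : DecidableEquality G
    finite     : Finite G
    u          : 𝔽 → G
    χ          : G → 𝔽
    u-0        : u 0# ≡ ε
    u-+        : ∀ β γ → u β ∙ u γ ≡ u (β + γ)
    u-injective : ∀ {β γ} → u β ≡ u γ → β ≡ γ
    χ-1        : χ ε ≡ 1#
    u-conj     : ∀ g β → g ∙ u β ≡ u (χ g * β) ∙ g
    commutator : ∀ g h → ∃[ ξ ] (g ∙ h) ∙ (h ∙ g) ⁻¹ ≡ u ξ

module Growth {F : FiniteField} (E : UnipotentExtension F) where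
  open UnipotentExtension E
  open FieldLemmas F

  group : Group 0ℓ 0ℓ
  group = record { isGroup = isGroup }

  open IsGroup isGroup using ()
    renaming (assoc to ∙-assoc; identityˡ to ∙-identityˡ; identityʳ to ∙-identityʳ)
  open Algebra.Properties.Group group
    using (∙-cancelˡ; ∙-cancelʳ; inverseʳ-unique; ⁻¹-anti-homo-∙; \\-leftDividesˡ; \\-leftDividesʳ; ε⁻¹≈ε)
    renaming (//-rightDividesˡ to ∙-//-rightDividesˡ; //-rightDividesʳ to ∙-//-rightDividesʳ)
  open Subsets isGroup renaming (inv to inverse)
  open FiniteSubsets finite using (∣_∣)

  open ≡-Reasoning

  u-⁻¹ : ∀ β → (u β ⁻¹) ≡ u (- β)
  u-⁻¹ β = sym (inverseʳ-unique (u β) (u (- β)) (trans (u-+ β (- β)) (trans (cong u (-‿inverseʳ β)) u-0)))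

  infixl 8 _^?_

  _^?_ : ∀ {A : Pred G 0ℓ} → Decidable A → ∀ n → Decidable (A ^ˢ n)
  _^?_ = ^ˢ-dec _≟ᴳ_ finite

  module Symmetric (A : Pred G 0ℓ) (A? : Decidable A) (ε∈A : ε ∈ A) (A≐A⁻¹ : A ≐ A ⁻¹ˢ) where

    module G = FiniteSubsets finite
    module K = FiniteSubsets 𝔽-finite

    A-⁻¹ : ∀ {x} → A x → A (x ⁻¹)
    A-⁻¹ Ax = proj₂ A≐A⁻¹ (_ , Ax , refl)

    ^-1 : ∀ {x} → A x → (A ^ˢ 1) x
    ^-1 Ax = _ , ε , Ax , refl , sym (∙-identityʳ _)

    ^-ε : ∀ n → (A ^ˢ n) ε
    ^-ε zero    = refl
    ^-ε (suc n) = ε , ε , ε∈A , ^-ε n , sym (∙-identityʳ ε)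

    ^-∙ : ∀ m {n x y} → (A ^ˢ m) x → (A ^ˢ n) y → (A ^ˢ (m ℕ.+ n)) (x ∙ y)
    ^-∙ zero {n} refl Ay = subst (A ^ˢ n) (sym (∙-identityˡ _)) Ay
    ^-∙ (suc m) (g , x , Ag , Ax , refl) Ay = g , _ , Ag , ^-∙ m Ax Ay , ∙-assoc _ _ _

    ^-∙-A : ∀ n {x g} → (A ^ˢ n) x → A g → (A ^ˢ suc n) (x ∙ g)
    ^-∙-A n {x} {g} Ax Ag = subst (λ m → (A ^ˢ m) (x ∙ g)) (ℕ.+-comm n 1) (^-∙ n Ax (^-1 Ag))

    ^-⁻¹ : ∀ n {x} → (A ^ˢ n) x → (A ^ˢ n) (x ⁻¹)
    ^-⁻¹ zero    refl = sym ε⁻¹≈ε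
    ^-⁻¹ (suc n) (g , x , Ag , Ax , refl) =
      subst (A ^ˢ suc n) (sym (⁻¹-anti-homo-∙ g x)) (^-∙-A n (^-⁻¹ n Ax) (A-⁻¹ Ag))

    ^-mono : ∀ {m n} → m ℕ.≤ n → A ^ˢ m ⊆ A ^ˢ n
    ^-mono {n = n} z≤n refl = ^-ε n
    ^-mono (s≤s m≤n) (g , x , Ag , Ax , eq) = g , x , Ag , ^-mono m≤n Ax , eq

    -- The second factor is written as y⁻¹ x so that a factorisation is given by `y` alone, which
    -- can then be chosen by `selector`.
    ^-split : ∀ m {n x} → (A ^ˢ (m ℕ.+ n)) x → ∃[ y ] (A ^ˢ m) y × (A ^ˢ n) (y ⁻¹ ∙ x)
    ^-split zero {n} {x} Ax = ε , refl , subst (A ^ˢ n) (sym (trans (cong (_∙ x) ε⁻¹≈ε) (∙-identityˡ x))) Ax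
    ^-split (suc m) {n} (g , x , Ag , Ax , refl) with ^-split m Ax
    ... | y , Ay , Ayx = g ∙ y , (g , y , Ag , Ay , refl) , subst (A ^ˢ n) (sym (begin
      (g ∙ y) ⁻¹ ∙ (g ∙ x)       ≡⟨ cong (_∙ (g ∙ x)) (⁻¹-anti-homo-∙ g y) ⟩
      (y ⁻¹ ∙ g ⁻¹) ∙ (g ∙ x)    ≡⟨ ∙-assoc _ _ _ ⟩
      y ⁻¹ ∙ (g ⁻¹ ∙ (g ∙ x))    ≡⟨ cong (y ⁻¹ ∙_) (\\-leftDividesʳ g x) ⟩
      y ⁻¹ ∙ x                   ∎)) Ayx

    ⟨⟩⇒^ : ∀ {x} → ⟨ A ⟩ x → ∃[ n ] (A ^ˢ n) x
    ⟨⟩⇒^ (gen Ax) = 1 , ^-1 Ax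
    ⟨⟩⇒^ one = 0 , refl
    ⟨⟩⇒^ (mul p q) with ⟨⟩⇒^ p | ⟨⟩⇒^ q
    ... | m , Ax | n , Ay = m ℕ.+ n , ^-∙ m Ax Ay
    ⟨⟩⇒^ (inverse p) with ⟨⟩⇒^ p
    ... | n , Ax = n , ^-⁻¹ n Ax

    -- Ruzsa's triangle inequality |X Z⁻¹| |Y| ≤ |X Y⁻¹| |Y Z⁻¹| for X = Aᵏ, Y = A, Z = Aˡ.
    ruzsa : ∀ k l → ∣ A? ^? (k ℕ.+ l) ∣ ℕ.* ∣ A? ∣ ℕ.≤ ∣ A? ^? suc k ∣ ℕ.* ∣ A? ^? suc l ∣
    ruzsa k l = subst₂ ℕ._≤_ (length-pairs finite finite (A? ^? (k ℕ.+ l)) A?)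
      (length-pairs finite finite (A? ^? suc k) (A? ^? suc l))
      (length-injection (λ (x , y) (s , t) → s ≡ p x ∙ y × t ≡ y ⁻¹ ∙ (p x ⁻¹ ∙ x))
        (pairs-unique finite finite (A? ^? (k ℕ.+ l)) A?)
        (λ {(x , y)} xy∈ → let Ax , Ay = ∈-pairs⁻ finite finite (A? ^? (k ℕ.+ l)) A? xy∈
                               Ap , Aq = p-∈ (proj₂ (^-split k Ax)) in
          _ , ∈-pairs⁺ finite finite (A? ^? suc k) (A? ^? suc l) (^-∙-A k Ap Ay)
                (y ⁻¹ , _ , A-⁻¹ Ay , Aq , refl) , refl , refl)
        (λ { {x , y} {x′ , y′} _ _ (refl , refl) (e , e′) →
          same (trans (product x y) (trans (cong₂ _∙_ e e′) (sym (product x′ y′)))) e }))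
      where
      choice = G.selector {P = λ x y → (A ^ˢ k) y × (A ^ˢ l) (y ⁻¹ ∙ x)}
        (λ x y → (A? ^? k) y ×-dec (A? ^? l) (y ⁻¹ ∙ x)) ε

      p : G → G
      p = proj₁ choice

      p-∈ : ∀ {x y} → (A ^ˢ k) y × (A ^ˢ l) (y ⁻¹ ∙ x) → (A ^ˢ k) (p x) × (A ^ˢ l) (p x ⁻¹ ∙ x)
      p-∈ = proj₂ choice

      -- The two coordinates multiply to x; this determines `p x`, and then the first coordinate
      -- determines y.
      product : ∀ x y → x ≡ (p x ∙ y) ∙ (y ⁻¹ ∙ (p x ⁻¹ ∙ x))
      product x y = sym (trans (∙-assoc _ _ _) (trans (cong (p x ∙_) (\\-leftDividesˡ y _)) (\\-leftDividesˡ (p x) x)))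

      same : ∀ {x x′ y y′} → x ≡ x′ → p x ∙ y ≡ p x′ ∙ y′ → (x , y) ≡ (x′ , y′)
      same {x} refl e = cong (x ,_) (∙-cancelˡ (p x) _ _ e)

    Υ : Pred 𝔽 0ℓ
    Υ y = ∃[ g ] A g × χ g ≡ y

    Υ? : Decidable Υ
    Υ? y = G.any? λ g → A? g ×-dec (χ g ≟ y)

    V : ℕ → Pred 𝔽 0ℓ
    V n β = (A ^ˢ n) (u β)

    V? : ∀ n → Decidable (V n)
    V? n β = (A? ^? n) (u β)

    V-0 : ∀ n → V n 0#
    V-0 n = subst (A ^ˢ n) (sym u-0) (^-ε n)

    V-+ : ∀ {m n x y} → V m x → V n y → V (m ℕ.+ n) (x + y)
    V-+ {m} {n} Vx Vy = subst (A ^ˢ (m ℕ.+ n)) (u-+ _ _) (^-∙ m Vx Vy)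

    V-neg : ∀ {n x} → V n x → V n (- x)
    V-neg {n} Vx = subst (A ^ˢ n) (u-⁻¹ _) (^-⁻¹ n Vx)

    -- Conjugation by `g` multiplies by `χ g`, at the cost of one letter on each side.
    Υ-V : ∀ {n x y} → Υ y → V n x → V (2 ℕ.+ n) (y * x)
    Υ-V {n} {x} (g , Ag , refl) Vx = g , u x ∙ g ⁻¹ , Ag , ^-∙-A n Vx (A-⁻¹ Ag) ,
      trans (sym (∙-//-rightDividesʳ g _)) (trans (cong (_∙ g ⁻¹) (sym (u-conj g x))) (∙-assoc _ _ _))

    -- Map (β , g) to x = u β ∙ g ∈ Aⁿ⁺¹. Compared with one chosen factorisation u (r x) ∙ g′ of the
    -- same x, the element u (β - r x) = g′ g⁻¹ lies in A², so each fibre embeds in `V 2`.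
    V-≤ : ∀ n → K.∣ V? n ∣ ℕ.* ∣ A? ∣ ℕ.≤ ∣ A? ^? suc n ∣ ℕ.* K.∣ V? 2 ∣
    V-≤ n = subst₂ ℕ._≤_ (length-pairs 𝔽-finite finite (V? n) A?)
      (length-pairs finite 𝔽-finite (A? ^? suc n) (V? 2))
      (length-injection (λ (β , g) (x , γ) → x ≡ u β ∙ g × γ ≡ β - r x)
        (pairs-unique 𝔽-finite finite (V? n) A?)
        (λ {(β , g)} p∈ → let Vβ , Ag = ∈-pairs⁻ 𝔽-finite finite (V? n) A? p∈ in
          _ , ∈-pairs⁺ finite 𝔽-finite (A? ^? suc n) (V? 2) (^-∙-A n Vβ Ag) (difference Vβ Ag)
            , refl , refl)
        (λ { {β , g} {β′ , g′} _ _ (refl , refl) (e , e′) → same (+-cancelʳ _ β β′ e′) e }))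
      where
      choice = K.selector {P = λ x β → V n β × A (u (- β) ∙ x)}
        (λ x β → V? n β ×-dec A? (u (- β) ∙ x)) 0#

      r : G → 𝔽
      r = proj₁ choice

      u-cancel : ∀ ρ β g → (u (- ρ) ∙ (u β ∙ g)) ∙ g ⁻¹ ≡ u (β - ρ)
      u-cancel ρ β g = begin
        (u (- ρ) ∙ (u β ∙ g)) ∙ g ⁻¹  ≡⟨ cong (_∙ g ⁻¹) (∙-assoc _ _ _) ⟨
        ((u (- ρ) ∙ u β) ∙ g) ∙ g ⁻¹  ≡⟨ ∙-//-rightDividesʳ g _ ⟩
        u (- ρ) ∙ u β                 ≡⟨ u-+ _ _ ⟩
        u (- ρ + β)                   ≡⟨ cong u (+-comm _ _) ⟩
        u (β - ρ)                     ∎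

      difference : ∀ {β g} → V n β → A g → V 2 (β - r (u β ∙ g))
      difference {β} {g} Vβ Ag = subst (A ^ˢ 2) (u-cancel _ β g) (^-∙-A 1 (^-1 Aρ) (A-⁻¹ Ag))
        where
        Aρ : A (u (- r (u β ∙ g)) ∙ (u β ∙ g))
        Aρ = proj₂ (proj₂ choice (Vβ , subst A (sym
          (trans (cong (_∙ (u β ∙ g)) (sym (u-⁻¹ β))) (\\-leftDividesʳ (u β) g))) Ag))

      same : ∀ {β β′ g g′} → β ≡ β′ → u β ∙ g ≡ u β′ ∙ g′ → (β , g) ≡ (β′ , g′)
      same {β} refl e = cong (β ,_) (∙-cancelˡ (u β) _ _ e)

    -- Dividing `g` by a chosen element of `A` with the same value of `χ` embeds each fibre of `χ`
    -- on `A` in A² ∩ `Scalar`.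
    A-≤ : {Scalar : Pred G 0ℓ} (scalar? : Decidable Scalar) →
      (∀ {g h} → χ g ≡ χ h → Scalar (h ⁻¹ ∙ g)) →
      ∣ A? ∣ ℕ.≤ K.∣ Υ? ∣ ℕ.* ∣ (A? ^? 2) ∩? scalar? ∣
    A-≤ scalar? χ-fibre = subst (∣ A? ∣ ℕ.≤_) (length-pairs 𝔽-finite finite Υ? ((A? ^? 2) ∩? scalar?))
      (length-injection (λ g (y , h) → y ≡ χ g × h ≡ r y ⁻¹ ∙ g) (G.list-unique A?)
        (λ {g} g∈ → let Ag = G.∈-list⁻ A? g∈
                        Ar , χr≡χg = proj₂ choice (Ag , refl) in
          _ , ∈-pairs⁺ 𝔽-finite finite Υ? ((A? ^? 2) ∩? scalar?) (g , Ag , refl)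
                (^-∙-A 1 (^-1 (A-⁻¹ Ar)) Ag , χ-fibre (sym χr≡χg)) , refl , refl)
        (λ { _ _ (refl , refl) (e , e′) → ∙-cancelˡ _ _ _ e′ }))
      where
      choice = G.selector {P = λ y g → A g × χ g ≡ y} (λ y g → A? g ×-dec (χ g ≟ y)) ε

      r : 𝔽 → G
      r = proj₁ choice

    module _ (n : ℕ) (28≤n : 28 ℕ.≤ n)
             (many : K.∣ V? n ∣ ℕ.+ K.∣ V? n ∣ ℕ.≤ K.∣ V? 2 ∣ ℕ.* K.∣ Υ? ∣) where

      open Pivots F Υ Υ? V V? V-0 (λ {m} {n} → V-+ {m} {n}) (λ {m} → V-neg {m})
        (λ m≤n → ^-mono m≤n) (λ {m} → Υ-V {m}) n 28≤n

      -- If `χ` were 1 on all of `A`, then |Υ| ≤ 1 and |V 2| |Υ| ≤ |V n| < 2 |V n|, against `many`.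
      nontrivial : ∃[ g ] A g × χ g ≢ 1#
      nontrivial with G.any? (λ g → A? g ×-dec ¬? (χ g ≟ 1#))
      ... | yes ∃g = ∃g
      ... | no ¬∃g = contradiction (ℕ.≤-trans many bound)
        (ℕ.<⇒≱ (ℕ.m<m+n K.∣ V? n ∣ (0<v many)))
        where
        Υ≤1 : K.∣ Υ? ∣ ℕ.≤ 1
        Υ≤1 = length-injection _≡_ {ys = 1# ∷ []} (K.list-unique Υ?)
          (λ y∈ → 1# , here refl , Υ⇒1 (K.∈-list⁻ Υ? y∈)) (λ _ _ p q → trans p (sym q))
          where
          Υ⇒1 : ∀ {y} → Υ y → y ≡ 1#
          Υ⇒1 (g , Ag , refl) with χ g ≟ 1#
          ... | yes eq = eq
          ... | no neq = contradiction (g , Ag , neq) ¬∃g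

        bound : K.∣ V? 2 ∣ ℕ.* K.∣ Υ? ∣ ℕ.≤ K.∣ V? n ∣
        bound = ℕ.≤-trans (ℕ.*-monoʳ-≤ K.∣ V? 2 ∣ Υ≤1) (ℕ.≤-trans (ℕ.≤-reflexive (ℕ.*-identityʳ _))
          (K.∣∣-mono (V? 2) (V? n) (^-mono (ℕ.≤-trans (ℕ.m≤m+n 2 26) 28≤n))))

      g₀ : G
      g₀ = proj₁ nontrivial

      -- The elements δ obey a cocycle rule δ(g h) = ξ + χ(g) δ(h), with u ξ the commutator of g and
      -- g₀. This is the shape that `nonPivot-step` handles, one letter at a time.
      commutators : ∀ m {g} → (A ^ˢ m) g → ∃[ δ ] NonPivot δ × g ∙ g₀ ≡ u δ ∙ (g₀ ∙ g)
      -- `χ g₀` and 1 = `χ ε` are two distinct elements of `Υ`, which suffices for 0.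
      commutators zero refl = 0# ,
        nonPivot-0 many (g₀ , proj₁ (proj₂ nontrivial) , refl) (ε , ε∈A , χ-1) (proj₂ (proj₂ nontrivial)) ,
        cong₂ _∙_ (sym u-0) (sym (∙-identityʳ g₀))
      commutators (suc m) (g , h , Ag , Ah , refl) with commutators m Ah
      ... | δ , Qδ , eq = ξ + χ g * δ , nonPivot-step many Vξ (g , Ag , refl) Qδ , (begin
        (g ∙ h) ∙ g₀                               ≡⟨ ∙-assoc _ _ _ ⟩
        g ∙ (h ∙ g₀)                               ≡⟨ cong (g ∙_) eq ⟩
        g ∙ (u δ ∙ (g₀ ∙ h))                       ≡⟨ ∙-assoc _ _ _ ⟨
        (g ∙ u δ) ∙ (g₀ ∙ h)                       ≡⟨ cong (_∙ (g₀ ∙ h)) (u-conj g δ) ⟩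
        (u (χ g * δ) ∙ g) ∙ (g₀ ∙ h)               ≡⟨ ∙-assoc _ _ _ ⟩
        u (χ g * δ) ∙ (g ∙ (g₀ ∙ h))               ≡⟨ cong (u (χ g * δ) ∙_) (∙-assoc _ _ _) ⟨
        u (χ g * δ) ∙ ((g ∙ g₀) ∙ h)               ≡⟨ cong (λ t → u (χ g * δ) ∙ (t ∙ h)) gg₀ ⟩
        u (χ g * δ) ∙ ((u ξ ∙ (g₀ ∙ g)) ∙ h)       ≡⟨ cong (u (χ g * δ) ∙_) (trans (∙-assoc _ _ _) (cong (u ξ ∙_) (∙-assoc _ _ _))) ⟩
        u (χ g * δ) ∙ (u ξ ∙ (g₀ ∙ (g ∙ h)))       ≡⟨ ∙-assoc _ _ _ ⟨
        (u (χ g * δ) ∙ u ξ) ∙ (g₀ ∙ (g ∙ h))       ≡⟨ cong (_∙ (g₀ ∙ (g ∙ h))) (trans (u-+ _ _) (cong u (+-comm _ _))) ⟩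
        u (ξ + χ g * δ) ∙ (g₀ ∙ (g ∙ h))           ∎)
        where
        ξ : 𝔽
        ξ = proj₁ (commutator g g₀)

        k≡u : (g ∙ g₀) ∙ (g₀ ∙ g) ⁻¹ ≡ u ξ
        k≡u = proj₂ (commutator g g₀)

        gg₀ : g ∙ g₀ ≡ u ξ ∙ (g₀ ∙ g)
        gg₀ = trans (sym (∙-//-rightDividesˡ (g₀ ∙ g) (g ∙ g₀))) (cong (_∙ (g₀ ∙ g)) k≡u)

        Ag₀ : A g₀
        Ag₀ = proj₁ (proj₂ nontrivial)

        Vξ : V 4 ξ
        -- The commutator is a word of four letters of `A`.
        Vξ = subst (A ^ˢ 4) k≡u
          (^-∙ 2 {2} (^-∙-A 1 (^-1 Ag) Ag₀) (^-⁻¹ 2 (^-∙-A 1 (^-1 Ag₀) Ag)))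

      V⇒nonPivot : ∀ {m w} → V m w → NonPivot w
      V⇒nonPivot {m} {w} Vw with commutators m Vw
      ... | δ , Qδ , eq = nonPivot-[1-s]* many (g₀ , proj₁ (proj₂ nontrivial) , refl)
        (proj₂ (proj₂ nontrivial)) (subst NonPivot (sym (trans (cong (_- χ g₀ * w) w≡) (//-rightDividesʳ _ δ))) Qδ)
        where
        w≡ : w ≡ δ + χ g₀ * w
        w≡ = u-injective (trans (∙-cancelʳ g₀ _ _ (trans eq (trans (cong (u δ ∙_) (u-conj g₀ w))
          (sym (∙-assoc _ _ _))))) (u-+ _ _))

      V-bounded : ∀ {m β} → V m β → V (n ℕ.+ n) β
      V-bounded {m} = V⊆V+V many (λ {m} → V⇒nonPivot {m}) {m}

      -- An element of ⟨A⟩ is a word of some length m, and `V-bounded` is uniform in m.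
      ⟨⟩-bounded : ∀ {N : Pred G 0ℓ} → (∀ {x} → N x → ∃[ β ] x ≡ u β) → ⟨ A ⟩ ∩ N ⊆ A ^ˢ (n ℕ.+ n)
      ⟨⟩-bounded N⇒u (x∈ , Nx) with ⟨⟩⇒^ x∈ | N⇒u Nx
      ... | m , Ax | β , refl = V-bounded {m} Ax

-- Rational estimates from small tripling.

module Tripling where
  open import Data.Rational using (_*_)
  open Algebra.Definitions.RawSemiring ℚ.+-*-rawSemiring using (_^_)

  -- Passing to unnormalised fractions avoids the gcd in `fromℕ`, which does not reduce on a
  -- variable.
  fromℕ-≃ : ∀ n → ℚ.toℚᵘ (fromℕ n) ℚᵘ.≃ ℚᵘ.mkℚᵘ (ℤ.+ n) 0
  fromℕ-≃ n = ℚ.toℚᵘ-fromℚᵘ (ℚᵘ.mkℚᵘ (ℤ.+ n) 0)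

  fromℕ-mono-≤ : ∀ {m n} → m ℕ.≤ n → fromℕ m ≤ fromℕ n
  fromℕ-mono-≤ {m} {n} m≤n = ℚ.toℚᵘ-cancel-≤ (begin
    ℚ.toℚᵘ (fromℕ m)     ≃⟨ fromℕ-≃ m ⟩
    ℚᵘ.mkℚᵘ (ℤ.+ m) 0    ≤⟨ ℚᵘ.*≤* (ℤ.*-monoʳ-≤-nonNeg (ℤ.+ 1) (ℤ.+≤+ m≤n)) ⟩
    ℚᵘ.mkℚᵘ (ℤ.+ n) 0    ≃⟨ fromℕ-≃ n ⟨
    ℚ.toℚᵘ (fromℕ n)     ∎)
    where open ℚᵘ.≤-Reasoning

  fromℕ-* : ∀ m n → fromℕ (m ℕ.* n) ≡ fromℕ m * fromℕ n
  fromℕ-* m n = ℚ.toℚᵘ-injective (begin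
    ℚ.toℚᵘ (fromℕ (m ℕ.* n))                         ≈⟨ fromℕ-≃ (m ℕ.* n) ⟩
    ℚᵘ.mkℚᵘ (ℤ.+ (m ℕ.* n)) 0                        ≡⟨ cong (λ i → ℚᵘ.mkℚᵘ i 0) (ℤ.pos-* m n) ⟩
    ℚᵘ.mkℚᵘ (ℤ.+ m) 0 ℚᵘ.* ℚᵘ.mkℚᵘ (ℤ.+ n) 0         ≈⟨ ℚᵘ.*-cong (fromℕ-≃ m) (fromℕ-≃ n) ⟨
    ℚ.toℚᵘ (fromℕ m) ℚᵘ.* ℚ.toℚᵘ (fromℕ n)           ≈⟨ ℚ.toℚᵘ-homo-* (fromℕ m) (fromℕ n) ⟨
    ℚ.toℚᵘ (fromℕ m * fromℕ n)                       ∎)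
    where open ℚᵘ.≃-Reasoning

  fromℕ-nonNegative : ∀ n → ℚ.NonNegative (fromℕ n)
  fromℕ-nonNegative n = ℚ.nonNegative (fromℕ-mono-≤ {0} {n} z≤n)

  fromℕ-positive : ∀ {n} → 0 ℕ.< n → ℚ.Positive (fromℕ n)
  fromℕ-positive {n} 0<n = ℚ.positive (ℚ.<-≤-trans (ℚ.positive⁻¹ 1ℚ) (fromℕ-mono-≤ {1} {n} 0<n))

  ^-inverse : ∀ {x y} n → x * y ≡ 1ℚ → x ^ n * y ^ n ≡ 1ℚ
  ^-inverse zero _ = refl
  ^-inverse {x} {y} (suc n) xy≡1 = begin
    x * x ^ n * (y * y ^ n)    ≡⟨ ℚ.*-assoc x (x ^ n) _ ⟩
    x * (x ^ n * (y * y ^ n))  ≡⟨ cong (x *_) (ℚ.*-assoc (x ^ n) y _) ⟨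
    x * (x ^ n * y * y ^ n)    ≡⟨ cong (λ t → x * (t * y ^ n)) (ℚ.*-comm (x ^ n) y) ⟩
    x * (y * x ^ n * y ^ n)    ≡⟨ cong (x *_) (ℚ.*-assoc y (x ^ n) _) ⟩
    x * (y * (x ^ n * y ^ n))  ≡⟨ cong (λ t → x * (y * t)) (^-inverse n xy≡1) ⟩
    x * (y * 1ℚ)               ≡⟨ cong (x *_) (ℚ.*-identityʳ y) ⟩
    x * y                      ≡⟨ xy≡1 ⟩
    1ℚ                         ∎
    where open ≡-Reasoning

  ^-positive : ∀ {x} → ℚ.Positive x → ∀ n → ℚ.Positive (x ^ n)
  ^-positive px zero    = _
  ^-positive {x} px (suc n) = ℚ.pos*pos⇒pos x {{px}} (x ^ n) {{^-positive px n}}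

  -- Applied with m = |A|, r = |Υ|, h = |A² ∩ H|, v = |V n|, v₂ = |V 2| and p = |Aⁿ⁺¹|.
  square-≤ : ∀ {m r h v v₂ p} → 0 ℕ.< v₂ → v₂ ℕ.* r ℕ.≤ v ℕ.+ v → m ℕ.≤ r ℕ.* h →
             v ℕ.* m ℕ.≤ p ℕ.* v₂ → m ℕ.* m ℕ.≤ h ℕ.* p ℕ.* 2
  square-≤ {m} {r} {h} {v} {v₂} {p} 0<v₂ few m≤rh vm≤ = ℕ.*-cancelˡ-≤ v₂ {{ℕ.>-nonZero 0<v₂}} (begin
    v₂ ℕ.* (m ℕ.* m)            ≤⟨ ℕ.*-monoʳ-≤ v₂ (ℕ.*-monoʳ-≤ m m≤rh) ⟩
    v₂ ℕ.* (m ℕ.* (r ℕ.* h))    ≡⟨ rearrange₁ v₂ m r h ⟩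
    v₂ ℕ.* r ℕ.* (h ℕ.* m)      ≤⟨ ℕ.*-monoˡ-≤ (h ℕ.* m) few ⟩
    (v ℕ.+ v) ℕ.* (h ℕ.* m)     ≡⟨ rearrange₂ v h m ⟩
    h ℕ.* 2 ℕ.* (v ℕ.* m)       ≤⟨ ℕ.*-monoʳ-≤ (h ℕ.* 2) vm≤ ⟩
    h ℕ.* 2 ℕ.* (p ℕ.* v₂)      ≡⟨ rearrange₃ h p v₂ ⟩
    v₂ ℕ.* (h ℕ.* p ℕ.* 2)      ∎)
    where
    open ℕ.≤-Reasoning
    rearrange₁ : ∀ v₂ m r h → v₂ ℕ.* (m ℕ.* (r ℕ.* h)) ≡ v₂ ℕ.* r ℕ.* (h ℕ.* m)
    rearrange₁ = solve-∀
    rearrange₂ : ∀ v h m → (v ℕ.+ v) ℕ.* (h ℕ.* m) ≡ h ℕ.* 2 ℕ.* (v ℕ.* m)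
    rearrange₂ = solve-∀
    rearrange₃ : ∀ h p v₂ → h ℕ.* 2 ℕ.* (p ℕ.* v₂) ≡ v₂ ℕ.* (h ℕ.* p ℕ.* 2)
    rearrange₃ = solve-∀

  module _ (K : ℚ) (1≤K : 1ℚ ≤ K) where
    private
      instance
        K-positive : ℚ.Positive K
        K-positive = ℚ.positive (ℚ.<-≤-trans (ℚ.positive⁻¹ 1ℚ) 1≤K)

        K-nonNegative : ℚ.NonNegative K
        K-nonNegative = ℚ.pos⇒nonNeg K

    -- Applied with f n = |Aⁿ| and m = |A|, where ruzsa gives f (k + 4) ≤ K f (k + 3).
    tripling : ∀ (f : ℕ → ℕ) {m} → 0 ℕ.< m → (∀ k l → f (k ℕ.+ l) ℕ.* m ℕ.≤ f (suc k) ℕ.* f (suc l)) →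
               fromℕ (f 3) ≤ K * fromℕ m → ∀ k → fromℕ (f (3 ℕ.+ k)) ≤ K ^ suc k * fromℕ m
    tripling f {m} 0<m ruzsa small zero = ℚ.≤-trans small
      (ℚ.≤-reflexive (cong (_* fromℕ m) (sym (ℚ.*-identityʳ K))))
    tripling f {m} 0<m ruzsa small (suc k) = ℚ.*-cancelʳ-≤-pos (fromℕ m) {{fromℕ-positive 0<m}} (begin
      fromℕ (f (4 ℕ.+ k)) * fromℕ m
        ≡⟨ fromℕ-* (f (4 ℕ.+ k)) m ⟨
      fromℕ (f (4 ℕ.+ k) ℕ.* m)
        ≤⟨ fromℕ-mono-≤ {f (4 ℕ.+ k) ℕ.* m} (subst (λ i → f i ℕ.* m ℕ.≤ f (3 ℕ.+ k) ℕ.* f 3)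
             (ℕ.+-comm (2 ℕ.+ k) 2) (ruzsa (2 ℕ.+ k) 2)) ⟩
      fromℕ (f (3 ℕ.+ k) ℕ.* f 3)
        ≡⟨ fromℕ-* (f (3 ℕ.+ k)) (f 3) ⟩
      fromℕ (f (3 ℕ.+ k)) * fromℕ (f 3)
        ≤⟨ ℚ.*-monoˡ-≤-nonNeg (fromℕ (f (3 ℕ.+ k))) {{fromℕ-nonNegative (f (3 ℕ.+ k))}} small ⟩
      fromℕ (f (3 ℕ.+ k)) * (K * fromℕ m)
        ≡⟨ ℚ.*-assoc (fromℕ (f (3 ℕ.+ k))) K (fromℕ m) ⟨
      fromℕ (f (3 ℕ.+ k)) * K * fromℕ m
        ≡⟨ cong (_* fromℕ m) (ℚ.*-comm (fromℕ (f (3 ℕ.+ k))) K) ⟩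
      K * fromℕ (f (3 ℕ.+ k)) * fromℕ m
        ≤⟨ ℚ.*-monoʳ-≤-nonNeg (fromℕ m) {{fromℕ-nonNegative m}}
             (ℚ.*-monoˡ-≤-nonNeg K (tripling f 0<m ruzsa small k)) ⟩
      K * (K ^ suc k * fromℕ m) * fromℕ m
        ≡⟨ cong (_* fromℕ m) (ℚ.*-assoc K (K ^ suc k) (fromℕ m)) ⟨
      K ^ suc (suc k) * fromℕ m * fromℕ m ∎)
      where open ℚ.≤-Reasoning

    -- From m² ≤ 2hp and p ≤ Kᶜ m, with C as the exponent, m ≤ 2 h Kᶜ follows; the 2 becomes the
    -- constant ½.
    large-intersection : ∀ C {m h p} → 0 ℕ.< m → fromℕ p ≤ K ^ C * fromℕ m →
      m ℕ.* m ℕ.≤ h ℕ.* p ℕ.* 2 → ½ * K ^- C ⟨ 1≤K ⟩ * fromℕ m ≤ fromℕ h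
    large-intersection C {m} {h} {p} 0<m p≤ mm≤ = begin
      ½ * I * fromℕ m
        ≤⟨ ℚ.*-monoˡ-≤-nonNeg (½ * I) {{½I-nonNegative}} m≤ ⟩
      ½ * I * (fromℕ h * (K ^ C * fromℕ 2))
        ≡⟨ ℚ.*-comm (½ * I) _ ⟩
      fromℕ h * (K ^ C * fromℕ 2) * (½ * I)
        ≡⟨ ℚ.*-assoc (fromℕ h) _ _ ⟩
      fromℕ h * (K ^ C * fromℕ 2 * (½ * I))
        ≡⟨ cong (fromℕ h *_) (ℚ.*-assoc (K ^ C) (fromℕ 2) (½ * I)) ⟩
      fromℕ h * (K ^ C * (fromℕ 2 * (½ * I)))
        ≡⟨ cong (λ t → fromℕ h * (K ^ C * t)) (trans (sym (ℚ.*-assoc (fromℕ 2) ½ I)) (ℚ.*-identityˡ I)) ⟩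
      fromℕ h * (K ^ C * I)
        ≡⟨ cong (fromℕ h *_) (^-inverse C (ℚ.*-inverseʳ K {{K≢0}})) ⟩
      fromℕ h * 1ℚ
        ≡⟨ ℚ.*-identityʳ (fromℕ h) ⟩
      fromℕ h ∎
      where
      open ℚ.≤-Reasoning

      K≢0 : ℚ.NonZero K
      K≢0 = ℚ.>-nonZero (ℚ.<-≤-trans (ℚ.positive⁻¹ 1ℚ) 1≤K)

      I : ℚ
      I = K ^- C ⟨ 1≤K ⟩

      I-positive : ℚ.Positive I
      I-positive = ^-positive (ℚ.1/pos⇒pos K) C

      ½I-nonNegative : ℚ.NonNegative (½ * I)
      ½I-nonNegative = ℚ.pos⇒nonNeg (½ * I) {{ℚ.pos*pos⇒pos ½ I {{I-positive}}}}

      m≤ : fromℕ m ≤ fromℕ h * (K ^ C * fromℕ 2)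
      m≤ = ℚ.*-cancelʳ-≤-pos (fromℕ m) {{fromℕ-positive 0<m}} (begin
        fromℕ m * fromℕ m
          ≡⟨ fromℕ-* m m ⟨
        fromℕ (m ℕ.* m)
          ≤⟨ fromℕ-mono-≤ {m ℕ.* m} mm≤ ⟩
        fromℕ (h ℕ.* p ℕ.* 2)
          ≡⟨ trans (fromℕ-* (h ℕ.* p) 2) (cong (_* fromℕ 2) (fromℕ-* h p)) ⟩
        fromℕ h * fromℕ p * fromℕ 2
          ≤⟨ ℚ.*-monoʳ-≤-nonNeg (fromℕ 2) (ℚ.*-monoˡ-≤-nonNeg (fromℕ h) {{fromℕ-nonNegative h}} p≤) ⟩
        fromℕ h * (K ^ C * fromℕ m) * fromℕ 2
          ≡⟨ ℚ.*-assoc (fromℕ h) _ (fromℕ 2) ⟩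
        fromℕ h * (K ^ C * fromℕ m * fromℕ 2)
          ≡⟨ cong (fromℕ h *_) (trans (ℚ.*-assoc (K ^ C) (fromℕ m) (fromℕ 2))
               (trans (cong (K ^ C *_) (ℚ.*-comm (fromℕ m) (fromℕ 2))) (sym (ℚ.*-assoc (K ^ C) (fromℕ 2) (fromℕ m))))) ⟩
        fromℕ h * (K ^ C * fromℕ 2 * fromℕ m)
          ≡⟨ ℚ.*-assoc (fromℕ h) _ (fromℕ m) ⟨
        fromℕ h * (K ^ C * fromℕ 2) * fromℕ m ∎)

    -- The equation matches the index 3 + j of `tripling` with n + 1, which makes the exponent of K
    -- equal to j + 1 = n - 1.
    ruzsa⇒large-intersection : ∀ (f : ℕ → ℕ) (m h n j : ℕ) → 0 ℕ.< m →
      (∀ k l → f (k ℕ.+ l) ℕ.* m ℕ.≤ f (suc k) ℕ.* f (suc l)) → fromℕ (f 3) ≤ K * fromℕ m →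
      3 ℕ.+ j ≡ suc n → m ℕ.* m ℕ.≤ h ℕ.* f (suc n) ℕ.* 2 →
      ½ * K ^- suc j ⟨ 1≤K ⟩ * fromℕ m ≤ fromℕ h
    ruzsa⇒large-intersection f m h n j 0<m ruzsa small refl mm≤ =
      large-intersection (suc j) {m} {h} {f (3 ℕ.+ j)} 0<m (tripling f {m} 0<m ruzsa small j) mm≤

open Tripling using (square-≤; ruzsa⇒large-intersection)

-- Normal subgroups of ⟨A⟩ with abelian quotient.

module Intersections {G : Set} {_∙_ : Op₂ G} {ε : G} {_⁻¹ : Op₁ G} (isGroup : IsGroup _≡_ _∙_ ε _⁻¹) where
  open Subsets isGroup

  module _ (A : Pred G 0ℓ) {N : Pred G 0ℓ} (N-isSubgroup : IsSubgroup N)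
           (N-conj : ∀ h {x} → N x → N ((h ∙ x) ∙ (h ⁻¹))) where

    private module N = IsSubgroup N-isSubgroup

    ⟨⟩∩-⊴ : (⟨ A ⟩ ∩ N) ⊴ ⟨ A ⟩
    ⟨⟩∩-⊴ = record
      { isSubgroupˡ = record
        { ε∈  = one , N.ε∈
        ; ∙∈  = λ (p , q) (p′ , q′) → mul p p′ , N.∙∈ q q′
        ; ⁻¹∈ = λ (p , q) → inv p , N.⁻¹∈ q
        }
      ; isSubgroupʳ = ⟨⟩-isSubgroup A
      ; subset = proj₁
      ; conj = λ {h} h∈ (p , q) → mul (mul h∈ p) (inv h∈) , N-conj h q
      }

    quotient-abelian : (∀ x y → N (((x ∙ y) ⁻¹) ∙ (y ∙ x))) → IsAbelian (quotient ⟨⟩∩-⊴)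
    quotient-abelian commutator∈N (x , x∈) (y , y∈) = mul (inv (mul x∈ y∈)) (mul y∈ x∈) , commutator∈N x y

-- The triangular group as a unipotent extension.

module TriangularLemmas (F : FiniteField) where
  open FieldLemmas F
  open Triangular F renaming (inv to inverse)
  open T₂

  open ≡-Reasoning

  inv-inverseʳ : ∀ {x} (x≢0 : x ≢ 0#) → x * inv x≢0 ≡ 1#
  inv-inverseʳ x≢0 = trans (*-comm _ _) (inv-inverseˡ x≢0)

  χ : T₂ → 𝔽
  χ g = a g * inv (d≢0 g)

  u : 𝔽 → T₂
  u β = mk 1# β 1# 1≢0 1≢0

  u-∙ : ∀ β γ → u β ∙ u γ ≡ u (β + γ)
  u-∙ β γ = T₂-≡ (*-identityˡ 1#)
    (trans (cong₂ _+_ (*-identityˡ γ) (*-identityʳ β)) (+-comm γ β)) (*-identityˡ 1#)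

  u-conj : ∀ g β → g ∙ u β ≡ u (χ g * β) ∙ g
  u-conj g β = T₂-≡ (*-comm _ _) (begin
    a g * β + b g * 1#                            ≡⟨ +-comm _ _ ⟩
    b g * 1# + a g * β                            ≡⟨ cong₂ _+_ (*-comm _ _) (sym conj-b) ⟩
    1# * b g + a g * inv (d≢0 g) * β * d g        ∎) (*-comm _ _)
    where
    conj-b : a g * inv (d≢0 g) * β * d g ≡ a g * β
    conj-b = begin
      a g * inv (d≢0 g) * β * d g      ≡⟨ cong (_* d g) (*-assoc _ _ _) ⟩
      a g * (inv (d≢0 g) * β) * d g    ≡⟨ *-assoc _ _ _ ⟩
      a g * (inv (d≢0 g) * β * d g)    ≡⟨ cong (a g *_) (*-comm _ _) ⟩
      a g * (d g * (inv (d≢0 g) * β))  ≡⟨ cong (a g *_) (*-assoc _ _ _) ⟨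
      a g * (d g * inv (d≢0 g) * β)    ≡⟨ cong (λ t → a g * (t * β)) (inv-inverseʳ (d≢0 g)) ⟩
      a g * (1# * β)                   ≡⟨ cong (a g *_) (*-identityˡ β) ⟩
      a g * β                          ∎

  U₂⇒u : ∀ {x} → x ∈ U₂ → x ≡ u (b x)
  U₂⇒u (a≡1 , d≡1) = T₂-≡ a≡1 refl d≡1

  *-inv≡1 : ∀ {x y} (y≢0 : y ≢ 0#) → x ≡ y → x * inv y≢0 ≡ 1#
  *-inv≡1 y≢0 refl = inv-inverseʳ y≢0

  commutator∈U₂ : ∀ x y → ((x ∙ y) ∙ (y ∙ x) ⁻¹) ∈ U₂
  commutator∈U₂ x y = *-inv≡1 (a≢0 (y ∙ x)) (*-comm _ _) , *-inv≡1 (d≢0 (y ∙ x)) (*-comm _ _)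

  inv≡1 : ∀ {x} (x≢0 : x ≢ 0#) → x ≡ 1# → inv x≢0 ≡ 1#
  inv≡1 x≢0 refl = trans (sym (*-identityʳ _)) (inv-inverseˡ x≢0)

  U₂-isSubgroup : IsSubgroup U₂
  U₂-isSubgroup = record
    { ε∈  = refl , refl
    ; ∙∈  = λ (p , q) (p′ , q′) →
        trans (cong₂ _*_ p p′) (*-identityˡ 1#) , trans (cong₂ _*_ q q′) (*-identityˡ 1#)
    ; ⁻¹∈ = λ {x} (p , q) → inv≡1 (a≢0 x) p , inv≡1 (d≢0 x) q
    }

  U₂-conj : ∀ h {x} → x ∈ U₂ → ((h ∙ x) ∙ h ⁻¹) ∈ U₂
  U₂-conj h (p , q) =
      *-inv≡1 (a≢0 h) (trans (cong (a h *_) p) (*-identityʳ _))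
    , *-inv≡1 (d≢0 h) (trans (cong (d h *_) q) (*-identityʳ _))

  -- The inverse stands on the left here, as in the equality of `quotient`, unlike in
  -- `commutator∈U₂`.
  U₂-quotient : ∀ x y → ((x ∙ y) ⁻¹ ∙ (y ∙ x)) ∈ U₂
  U₂-quotient x y =
      trans (*-comm _ _) (*-inv≡1 (a≢0 (x ∙ y)) (*-comm _ _))
    , trans (*-comm _ _) (*-inv≡1 (d≢0 (x ∙ y)) (*-comm _ _))

  -- Scalar only on the diagonal: this is the whole F*-potent group, the kernel of `χ`.
  Scalar : Pred T₂ 0ℓ
  Scalar x = a x ≡ d x

  scalar? : Decidable Scalar
  scalar? x = a x ≟ d x

  inv-cong : ∀ {x y} (x≢0 : x ≢ 0#) (y≢0 : y ≢ 0#) → x ≡ y → inv x≢0 ≡ inv y≢0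
  inv-cong x≢0 y≢0 refl = refl

  scalar-isF*PotentGroup : IsF*PotentGroup Scalar
  scalar-isF*PotentGroup = record
    { isSubgroup = record
      { ε∈ = refl ; ∙∈ = cong₂ _*_ ; ⁻¹∈ = λ {x} → inv-cong (a≢0 x) (d≢0 x) }
    ; potent = λ {x} a≡d → (a x , a≢0 x) , u (inv (a≢0 x) * b x) , (refl , refl) ,
        T₂-≡ (sym (*-identityʳ _))
             (trans (sym (*-identityˡ _)) (trans (cong (_* b x) (sym (inv-inverseʳ (a≢0 x)))) (*-assoc _ _ _)))
             (trans (sym a≡d) (sym (*-identityʳ _)))
    }

  χ-fibre : ∀ {g h} → χ g ≡ χ h → Scalar (h ⁻¹ ∙ g)
  χ-fibre {g} {h} eq = *-cancelˡ-≢0 (a≢0 h) (begin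
    a h * (inv (a≢0 h) * a g)        ≡⟨ *-assoc _ _ _ ⟨
    a h * inv (a≢0 h) * a g          ≡⟨ cong (_* a g) (inv-inverseʳ (a≢0 h)) ⟩
    1# * a g                         ≡⟨ *-comm _ _ ⟩
    a g * 1#                         ≡⟨ cong (a g *_) (inv-inverseˡ (d≢0 g)) ⟨
    a g * (inv (d≢0 g) * d g)        ≡⟨ *-assoc _ _ _ ⟨
    χ g * d g                        ≡⟨ cong (_* d g) eq ⟩
    χ h * d g                        ≡⟨ *-assoc _ _ _ ⟩
    a h * (inv (d≢0 h) * d g)        ∎)

  extension : UnipotentExtension F
  extension = record
    { G = T₂ ; _∙_ = _∙_ ; ε = ε ; _⁻¹ = _⁻¹ ; isGroup = isGroup
    ; _≟ᴳ_ = T₂-≟ ; finite = finite ; u = u ; χ = χ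
    ; u-0 = refl ; u-+ = u-∙ ; u-injective = cong b ; χ-1 = inv-inverseʳ 1≢0 ; u-conj = u-conj
    ; commutator = λ g h → _ , U₂⇒u (commutator∈U₂ g h)
    }

  module _ (A : Pred T₂ 0ℓ) (A? : Decidable A) (ε∈A : ε ∈ A) (A≐A⁻¹ : A ≐ A ⁻¹ˢ) where

    open Growth.Symmetric extension A A? ε∈A A≐A⁻¹

    -- `Few` leads to the first conclusion and `Many` to the second.
    Few Many : ℕ → Set
    Few n  = K.∣ V? 2 ∣ ℕ.* K.∣ Υ? ∣ ℕ.≤ K.∣ V? n ∣ ℕ.+ K.∣ V? n ∣
    Many n = K.∣ V? n ∣ ℕ.+ K.∣ V? n ∣ ℕ.≤ K.∣ V? 2 ∣ ℕ.* K.∣ Υ? ∣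

    few⊎many : ∀ n → Few n ⊎ Many n
    few⊎many n = ℕ.≤-total (K.∣ V? 2 ∣ ℕ.* K.∣ Υ? ∣) (K.∣ V? n ∣ ℕ.+ K.∣ V? n ∣)

    bounded : ∀ n → 28 ℕ.≤ n → Many n → ⟨ A ⟩ ∩ U₂ ⊆ A ^ˢ (n ℕ.+ n)
    bounded n 28≤n many = ⟨⟩-bounded n 28≤n many {U₂} (λ {x} x∈U₂ → b x , U₂⇒u x∈U₂)

    few⇒square-≤ : ∀ n → Few n → ∣ A? ∣ ℕ.* ∣ A? ∣ ℕ.≤
      ∣ (A? ^? 2) ∩? scalar? ∣ ℕ.* ∣ A? ^? suc n ∣ ℕ.* 2
    few⇒square-≤ n few = square-≤ {∣ A? ∣} {K.∣ Υ? ∣} {∣ (A? ^? 2) ∩? scalar? ∣} {K.∣ V? n ∣} {K.∣ V? 2 ∣}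
      {∣ A? ^? suc n ∣} (K.nonempty (V? 2) (V-0 2)) few (A-≤ scalar? (λ {g} {h} → χ-fibre {g} {h})) (V-≤ n)

    ruzsa′ : ∀ k l → ∣ A? ^? (k ℕ.+ l) ∣ ℕ.* ∣ A? ∣ ℕ.≤ ∣ A? ^? suc k ∣ ℕ.* ∣ A? ^? suc l ∣
    ruzsa′ = ruzsa

    nonempty : 0 ℕ.< ∣ A? ∣
    nonempty = G.nonempty A? ε∈A

    -- With inferred implicit arguments conversion would unfold fromℕ at huge cardinalities.
    few⇒large-intersection : ∀ {K} (1≤K : 1ℚ ≤ K) n j → 3 ℕ.+ j ≡ suc n → Few n →
      fromℕ (∣_∣ {A ^ˢ 3} (_^?_ {A} A? 3)) ≤ K ℚ.* fromℕ (∣_∣ {A} A?) →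
      ½ ℚ.* K ^- suc j ⟨ 1≤K ⟩ ℚ.* fromℕ (∣_∣ {A} A?) ≤
        fromℕ (∣_∣ {(A ^ˢ 2) ∩ Scalar} (_∩?_ {P = A ^ˢ 2} {Q = Scalar} (_^?_ {A} A? 2) scalar?))
    few⇒large-intersection {K} 1≤K n j 3+j≡1+n few small =
      ruzsa⇒large-intersection K 1≤K (λ k → ∣_∣ {A ^ˢ k} (_^?_ {A} A? k)) (∣_∣ {A} A?)
        (∣_∣ {(A ^ˢ 2) ∩ Scalar} (_∩?_ {P = A ^ˢ 2} {Q = Scalar} (_^?_ {A} A? 2) scalar?)) n j
        nonempty ruzsa′ small 3+j≡1+n (few⇒square-≤ n few)

-- The theorem with explicit constants.

open import Data.Rational using (_*_)

theorem3 : ∃[ c ] ∃[ C ] ∃[ N ] 0ℚ < c × 0 <ℕ C × 0 <ℕ N ×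
    ((F : FiniteField) → let open Triangular F in
    (K : ℚ) (1≤K : 1ℚ ≤ K) →
    (A : Pred T₂ 0ℓ) (A? : Decidable A) →
    ε ∈ A →
    A ≐ A ⁻¹ˢ →
    fromℕ ∣ A? ^? 3 ∣ ≤ K * fromℕ ∣ A? ∣ →
    (∃[ H ] Σ[ H? ∈ Decidable H ]
    IsF*PotentGroup H ×
    c * K ^- C ⟨ 1≤K ⟩ * fromℕ ∣ A? ∣ ≤ fromℕ ∣ (A? ^? 2) ∩? H? ∣)
    ⊎
    (∃[ U ] U ⊆ U₂ ×
    Σ[ U⊴⟨A⟩ ∈ U ⊴ ⟨ A ⟩ ]
    U ⊆ A ^ˢ N ×
    IsAbelian (quotient U⊴⟨A⟩)))
-- With n = 28, the exponent 27 comes from |A²⁹| ≤ K²⁷ |A|, and 56 = n + n from `V-bounded`.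
theorem3 = ½ , 27 , 56 , ℚ.positive⁻¹ ½ , s≤s z≤n , s≤s z≤n , λ F K 1≤K A A? ε∈A A≐A⁻¹ small →
  let open TriangularLemmas F
      open Triangular F
  in Sum.map
    (λ few → Scalar , scalar? , scalar-isF*PotentGroup ,
      few⇒large-intersection A A? ε∈A A≐A⁻¹ {K} 1≤K 28 26 refl few small)
    (λ many → ⟨ A ⟩ ∩ U₂ , proj₂ ,
      Intersections.⟨⟩∩-⊴ isGroup A U₂-isSubgroup (λ h {x} → U₂-conj h {x}) ,
      bounded A A? ε∈A A≐A⁻¹ 28 ℕ.≤-refl many ,
      Intersections.quotient-abelian isGroup A U₂-isSubgroup (λ h {x} → U₂-conj h {x}) U₂-quotient)
    (few⊎many A A? ε∈A A≐A⁻¹ 28)
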